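{- Let $S_n$ be the star on $n$ vertices with edge set $E$, let $f=\{i,j\}\notin E$ be a pair of distinct vertices, and let $B=E\cup\{f\}$. Let $\det(xI-\mathfrak{D}_2(S_n)[B,B])=\sum_{k=0}^n a_kx^k$ and let $|a_t|=\max_k|a_k|$. Then $\lfloor\frac{n-2}{2}\rfloor\le t\le\lceil\frac n2\rceil$.
   Context: For a tree $T$, let $\mathcal{V}_2$ be the set of 2-element vertex subsets (edges regarded as elements of $\mathcal{V}_2$). The 2-Steiner distance matrix $\mathfrak{D}_2(T)$ is indexed by $\mathcal{V}_2$, with entry in row $\{i,j\}$, column $\{k,l\}$ equal to the minimum number of edges of a connected subtree of $T$ whose vertex set contains $i,j,k,l$. $M[B,B]$ denotes the principal submatrix with rows and columns indexed by $B$. -}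

module Defs where

open import Algebra.Bundles.Raw using (RawRing)
import Algebra.Definitions.RawMonoid as RawMonoidDefs
open import Data.Fin.Base using (Fin; zero; suc; toℕ; punchIn; punchOut)
open import Data.Fin.Properties using (_≟_; punchInᵢ≢i; punchIn-injective; punchIn-punchOut)
open import Data.Fin.Subset using (Subset; ⊤; ⁅_⁆; _∪_; ∣_∣; _⊆_; Nonempty) renaming (_∈_ to _∈ₛ_)
open import Data.Fin.Subset.Properties using (∣⁅x⁆∣≡1; ∪-identityˡ; ∪-identityʳ; ∪-comm; ∈⊤; x∈⁅x⁆; x∈⁅y⁆⇒x≡y; x∈p∪q⁻; x∈p∪q⁺)
open import Data.Integer.Base as ℤ using (ℤ; 0ℤ; 1ℤ)
open import Data.List.Base as List using (List; []; _∷_; _∷ʳ_; length; tabulate; lookup)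
open import Data.List.Membership.Propositional using (_∈_)
open import Data.List.Membership.Propositional.Properties using (∈-tabulate⁺; ∈-tabulate⁻)
open import Data.List.Relation.Unary.All as All using (All; []; _∷_)
open import Data.List.Relation.Unary.AllPairs using ([]; _∷_)
open import Data.List.Relation.Unary.Linked using (Linked; []; [-]; _∷_)
open import Data.List.Relation.Unary.Unique.Propositional using (Unique)
open import Data.List.Relation.Unary.Unique.Propositional.Properties using (tabulate⁺)
open import Data.Nat.Base using (ℕ; zero; suc; _≤_; s≤s)
open import Data.Product.Base using (∃; ∃-syntax; _×_; _,_; proj₁; proj₂)
open import Data.Sum.Base using (_⊎_; inj₁; inj₂)
open import Function.Base using (_∘_)
open import Level using (0ℓ)
open import Relation.Binary.Construct.Closure.ReflexiveTransitive using (Star; ε; _◅_)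
open import Relation.Binary.PropositionalEquality using (_≡_; _≢_; refl; sym; trans; cong; subst)
open import Relation.Nullary using (¬_; yes; no; contradiction)

𝒱₂ : ℕ → Set
𝒱₂ n = ∃ λ (p : Subset n) → ∣ p ∣ ≡ 2

∣⁅i⁆∪⁅j⁆∣≡2 : ∀ {n} {i j : Fin n} → i ≢ j → ∣ ⁅ i ⁆ ∪ ⁅ j ⁆ ∣ ≡ 2
∣⁅i⁆∪⁅j⁆∣≡2 {i = zero}  {zero}  i≢j = contradiction refl i≢j
∣⁅i⁆∪⁅j⁆∣≡2 {i = zero}  {suc j} _   = cong suc (trans (cong ∣_∣ (∪-identityˡ ⁅ j ⁆)) (∣⁅x⁆∣≡1 j))
∣⁅i⁆∪⁅j⁆∣≡2 {i = suc i} {zero}  _   = cong suc (trans (cong ∣_∣ (∪-identityʳ ⁅ i ⁆)) (∣⁅x⁆∣≡1 i))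
∣⁅i⁆∪⁅j⁆∣≡2 {i = suc i} {suc j} i≢j = ∣⁅i⁆∪⁅j⁆∣≡2 (i≢j ∘ cong suc)

doubleton : ∀ {n} (i j : Fin n) → i ≢ j → 𝒱₂ n
doubleton i j i≢j = ⁅ i ⁆ ∪ ⁅ j ⁆ , ∣⁅i⁆∪⁅j⁆∣≡2 i≢j

-- The vertex set need not be all of Fin n, so that subgraphs are graphs.
record Graph (n : ℕ) : Set where
  field
    vertices : Subset n
    edges    : List (𝒱₂ n)
    unique   : Unique edges
    incident : All (λ e → proj₁ e ⊆ vertices) edges

  Adj : Fin n → Fin n → Set
  Adj u v = ∃[ e ] e ∈ edges × proj₁ e ≡ ⁅ u ⁆ ∪ ⁅ v ⁆

  Connected : Set
  Connected = ∀ {u v} → u ∈ₛ vertices → v ∈ₛ vertices → Star Adj u v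

  IsCycle : Fin n → List (Fin n) → Set
  IsCycle u vs = 2 ≤ length vs × Unique (u ∷ vs) × Linked Adj (u ∷ vs ∷ʳ u)

  Acyclic : Set
  Acyclic = ∀ u vs → ¬ IsCycle u vs

  size : ℕ
  size = length edges

record _⊑_ {n} (H G : Graph n) : Set where
  field
    vertices-⊆ : Graph.vertices H ⊆ Graph.vertices G
    edges-⊆    : ∀ {e} → e ∈ Graph.edges H → e ∈ Graph.edges G

record Tree (n : ℕ) : Set where
  field
    graph     : Graph n
    nonempty  : Nonempty (Graph.vertices graph)
    connected : Graph.Connected graph
    acyclic   : Graph.Acyclic graph

  open Graph graph public

record IsSubtreeContaining {n} (T : Tree n) (p q : 𝒱₂ n) (H : Tree n) : Set where
  field
    subgraph  : Tree.graph H ⊑ Tree.graph T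
    containsˡ : proj₁ p ⊆ Tree.vertices H
    containsʳ : proj₁ q ⊆ Tree.vertices H

record IsSteinerDistance {n} (T : Tree n) (p q : 𝒱₂ n) (d : ℕ) : Set where
  field
    attained : ∃[ H ] IsSubtreeContaining T p q H × Tree.size H ≡ d
    minimal  : ∀ H → IsSubtreeContaining T p q H → d ≤ Tree.size H

-- Such a D is unique, a minimum being determined by its defining property.
Is𝔇₂ : ∀ {n} → Tree n → (𝒱₂ n → 𝒱₂ n → ℕ) → Set
Is𝔇₂ T D = ∀ p q → IsSteinerDistance T p q (D p q)

-- As k ranges over Fin m, punchIn c k ranges over the vertices other than c.
spoke : ∀ {m} → Fin (suc m) → Fin m → 𝒱₂ (suc m)
spoke c k = doubleton c (punchIn c k) (punchInᵢ≢i c k ∘ sym)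

private
  spoke-injective : ∀ {m} (c : Fin (suc m)) {k l} → spoke c k ≡ spoke c l → k ≡ l
  spoke-injective c {k} {l} eq
    with x∈p∪q⁻ ⁅ c ⁆ ⁅ punchIn c l ⁆
           (subst (punchIn c k ∈ₛ_) (cong proj₁ eq) (x∈p∪q⁺ (inj₂ (x∈⁅x⁆ (punchIn c k)))))
  ... | inj₁ h = contradiction (x∈⁅y⁆⇒x≡y c h) (punchInᵢ≢i c k)
  ... | inj₂ h = punchIn-injective c k l (x∈⁅y⁆⇒x≡y _ h)

starGraph : ∀ {n} → Fin n → Graph n
starGraph {suc m} c = record
  { vertices = ⊤
  ; edges    = tabulate (spoke c)
  ; unique   = tabulate⁺ (spoke-injective c)
  ; incident = All.universal (λ _ {_} _ → ∈⊤) _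
  }

private
  module _ {m} (c : Fin (suc m)) where
    open Graph (starGraph c)

    adjˡ : ∀ v → c ≢ v → Adj c v
    adjˡ v c≢v =
      spoke c k , ∈-tabulate⁺ k , cong (λ w → ⁅ c ⁆ ∪ ⁅ w ⁆) (punchIn-punchOut c≢v)
      where k = punchOut c≢v

    adjʳ : ∀ v → c ≢ v → Adj v c
    adjʳ v c≢v with e , e∈ , eq ← adjˡ v c≢v = e , e∈ , trans eq (∪-comm ⁅ c ⁆ ⁅ v ⁆)

    fromCentre : ∀ v → Star Adj c v
    fromCentre v with c ≟ v
    ... | yes refl = ε
    ... | no  c≢v  = adjˡ v c≢v ◅ ε

    walk : ∀ u v → Star Adj u v
    walk u v with c ≟ u
    ... | yes refl = fromCentre v
    ... | no  c≢u  = adjʳ u c≢u ◅ fromCentre v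

    centre∈ : ∀ {u v} → Adj u v → c ≡ u ⊎ c ≡ v
    centre∈ {u} {v} (e , e∈ , eq) with k , refl ← ∈-tabulate⁻ e∈
      with x∈p∪q⁻ ⁅ u ⁆ ⁅ v ⁆ (subst (c ∈ₛ_) eq (x∈p∪q⁺ (inj₁ (x∈⁅x⁆ c))))
    ... | inj₁ h = inj₁ (x∈⁅y⁆⇒x≡y u h)
    ... | inj₂ h = inj₂ (x∈⁅y⁆⇒x≡y v h)

    noCycle : Acyclic
    noCycle u []      (() , _)
    noCycle u (_ ∷ []) (s≤s () , _)
    noCycle u (v ∷ w ∷ ws) (_ , (u≢v ∷ u≢w ∷ _) ∷ (v≢w ∷ v≢ws) ∷ _ , uv ∷ vw ∷ rest)
      with centre∈ uv | centre∈ vw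
    ... | inj₁ c≡u | inj₁ c≡v = u≢v (trans (sym c≡u) c≡v)
    ... | inj₁ c≡u | inj₂ c≡w = u≢w (trans (sym c≡u) c≡w)
    ... | inj₂ c≡v | inj₂ c≡w = v≢w (trans (sym c≡v) c≡w)
    ... | inj₂ c≡v | inj₁ _   = close ws v≢ws rest
      where
      close : ∀ xs → All (v ≢_) xs → ¬ Linked Adj (w ∷ xs ∷ʳ u)
      close [] _ (wu ∷ _) with centre∈ wu
      ... | inj₁ c≡w = v≢w (trans (sym c≡v) c≡w)
      ... | inj₂ c≡u = u≢v (trans (sym c≡u) c≡v)
      close (x ∷ _) (v≢x ∷ _) (wx ∷ _) with centre∈ wx
      ... | inj₁ c≡w = v≢w (trans (sym c≡v) c≡w)
      ... | inj₂ c≡x = v≢x (trans (sym c≡v) c≡x)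

star : ∀ {n} → Fin n → Tree n
star {suc m} c = record
  { graph     = starGraph c
  ; nonempty  = c , ∈⊤
  ; connected = λ {u} {v} _ _ → walk c u v
  ; acyclic   = noCycle c
  }

Matrix : Set → ℕ → Set
Matrix A n = Fin n → Fin n → A

-- The principal submatrix M[B,B], its index set B being listed without
-- repetition.  The characteristic polynomial does not depend on the order.
principalSubmatrix : ∀ {I A : Set} → (I → I → A) → (B : List I) → Matrix A (length B)
principalSubmatrix M B i j = M (lookup B i) (lookup B j)

module Determinant (R : RawRing 0ℓ 0ℓ) where
  open RawRing R
  open RawMonoidDefs +-rawMonoid using (sum)

  identity : ∀ {n} → Matrix Carrier n
  identity i j with i ≟ j
  ... | yes _ = 1#
  ... | no  _ = 0#

  sign : ℕ → Carrier
  sign zero    = 1#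
  sign (suc k) = - sign k

  -- Laplace expansion along the first row.
  det : ∀ {n} → Matrix Carrier n → Carrier
  det {zero}  M = 1#
  det {suc n} M = sum λ j → sign (toℕ j) * (M zero j * det λ r s → M (suc r) (punchIn j s))

-- Coefficient lists, constant term first; trailing zeros are allowed.
Poly : Set
Poly = List ℤ

coeff : Poly → ℕ → ℤ
coeff []      _       = 0ℤ
coeff (a ∷ _) zero    = a
coeff (_ ∷ p) (suc k) = coeff p k

infixl 6 _+ₚ_
infixl 7 _*ₚ_
infix  8 -ₚ_

_+ₚ_ : Poly → Poly → Poly
[]      +ₚ q       = q
(a ∷ p) +ₚ []      = a ∷ p
(a ∷ p) +ₚ (b ∷ q) = (a ℤ.+ b) ∷ (p +ₚ q)

-ₚ_ : Poly → Poly
-ₚ p = List.map (λ a → ℤ.- a) p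

_*ₚ_ : Poly → Poly → Poly
[]      *ₚ q = []
(a ∷ p) *ₚ q = List.map (a ℤ.*_) q +ₚ (0ℤ ∷ (p *ₚ q))

constant : ℤ → Poly
constant a = a ∷ []

X : Poly
X = 0ℤ ∷ 1ℤ ∷ []

ℤ[X] : RawRing 0ℓ 0ℓ
ℤ[X] = record
  { Carrier = Poly
  ; _≈_     = λ p q → ∀ k → coeff p k ≡ coeff q k
  ; _+_     = _+ₚ_
  ; _*_     = _*ₚ_
  ; -_      = -ₚ_
  ; 0#      = []
  ; 1#      = constant 1ℤ
  }

charPoly : ∀ {n} → Matrix ℤ n → Poly
charPoly M = det λ i j → X *ₚ identity i j +ₚ -ₚ constant (M i j)
  where open Determinant ℤ[X]

{-# OPTIONS --safe #-}
module Submission where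

-- With m = n − 1 leaves, the matrix has the block form [[2, vᵀ], [v, 2J − I]],
-- where v = 3·1 − e_p − e_q for f = {p, q}: a Steiner distance counts the leaves
-- involved.  Writing y = x + 1, an explicit solution c of (xI − M) c = t e₀ and
-- Cramer's rule give the characteristic polynomial
--   (x + 1)^(m−2) (x³ − 2m x² − 7(m−1) x − m).
-- All this is done at integer values of x large enough to avoid the zeros of
-- y (y − 2k), k ≤ m; infinitely many values determine the coefficients.
-- With N = m − 2, the k-th coefficient is, up to sign,
--   m C(N,k) + 7(m−1) C(N,k−1) + 2m C(N,k−2) − C(N,k−3),
-- and the absorption identity for binomial coefficients shows that consecutive
-- absolute values increase strictly up to ⌊(n−2)/2⌋ and decrease strictly from ⌈n/2⌉ on.

open import Defs
open import Algebra.Bundles using (CommutativeRing)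
open import Algebra.Bundles.Raw using (RawRing)
import Algebra.Definitions.RawMonoid as RawMonoidDefinitions
open import Data.Fin.Base using (Fin; zero; suc; toℕ; inject₁; punchIn; punchOut)
open import Data.Fin.Induction using (<-weakInduction)
open import Data.Fin.Properties using (_≟_; any?; injective⇒≤; punchIn-injective; punchInᵢ≢i; punchIn-punchOut; punchOut-injective)
open import Data.Fin.Subset using (Subset; ⁅_⁆; _∪_; _⊆_) renaming (_∈_ to _∈ₛ_; ∣_∣ to card)
open import Data.Fin.Subset.Properties using (_∈?_; ∣⁅x⁆∣≡1; ∪-comm; p⊆q⇒∣p∣≤∣q∣; x∈⁅x⁆; x∈⁅y⁆⇒x≡y; x∈p∪q⁻; x∈p∪q⁺; ∈⊤)
import Data.Integer.Base as ℤ
open import Data.Integer.Properties as ℤ using (+-*-commutativeRing)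
open import Data.List.Base as List using (List; []; _∷_; length; lookup)
open import Data.List.Membership.Propositional using (_∈_; _∉_)
open import Data.List.Membership.Propositional.Properties using (∈-lookup; ∈-map⁺; ∈-map⁻; ∈-tabulate⁺; ∈-tabulate⁻)
open import Data.List.Properties using (length-map; length-tabulate)
open import Data.List.Relation.Unary.All as All using (All; []; _∷_)
import Data.List.Relation.Unary.All.Properties as All
open import Data.List.Relation.Unary.AllPairs using ([]; _∷_)
open import Data.List.Relation.Unary.Any as Any using (here; there)
open import Data.List.Relation.Unary.Any.Properties using (lookup-index)
import Data.List.Relation.Unary.Linked as Linked
open import Data.List.Relation.Unary.Unique.Propositional using (Unique)
import Data.List.Relation.Unary.Unique.Propositional.Properties as Unique
open import Data.Nat.Base as ℕ using (ℕ; zero; suc; _≤_)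
open import Data.Nat.Combinatorics using (_C_; nCk+nC[k+1]≡[n+1]C[k+1]; nCn≡1; nC1≡n; nCk≡nC[n∸k]; k>n⇒nCk≡0)
import Data.Nat.Properties as ℕ
open import Data.Product.Base using (∃-syntax; _×_; _,_; proj₁; proj₂)
open import Data.Sum.Base using (_⊎_; inj₁; inj₂; [_,_]′)
open import Function.Base using (_∘_)
open import Relation.Binary.Construct.Closure.ReflexiveTransitive using (Star; ε; _◅_)
open import Relation.Binary.PropositionalEquality using (_≡_; _≢_; refl; sym; trans; cong; cong₂; subst; subst₂; ≢-sym; module ≡-Reasoning)
open import Relation.Nullary using (¬_; yes; no; contradiction; ¬?; _×-dec_)

open CommutativeRing +-*-commutativeRing using (semiring; rawRing)
open import Algebra.Properties.Semiring.Sum semiring using (sum; sum-cong-≗; ∑-distrib-+; *-distribˡ-sum; sum-replicate-zero)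
open Determinant rawRing using (det; sign; identity)
private module Det[X] = Determinant ℤ[X]
open RawMonoidDefinitions (RawRing.+-rawMonoid ℤ[X]) using () renaming (sum to sumₚ)

-- Determinants and polynomials over ℤ

-- Coefficient lists obey the ring laws only up to trailing zeros; at an integer point the same
-- identities are equations in ℤ, and a nonzero factor cancels. So the determinant formulas carry
-- extra factors y in place of quotients. The vector c comes from inverting the block yI - 2J: with
-- a = y - 2m and S₁ the sum of v, (yI - 2J)(a v + 2 S₁ 1) = y a v. Hence t is y a times the Schur
-- complement y - 3 - vᵀ(yI - 2J)⁻¹v. In the cubic only the leading coefficient is positive.
-- Comparing neighbouring coefficients is therefore termwise monotonicity of binomials, except that
-- C(N,k-3) enters with the opposite sign and its change can pull the wrong way; the change of 2m
-- C(N,k-2) has to outweigh it. The coefficient 1 at k = n has the other sign and needs its own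
-- comparison.

module _ where
  open import Data.Integer.Base using (ℤ; 0ℤ; 1ℤ; _+_; _*_; -_; _-_; _^_; ≢-nonZero; ∣_∣)
  open import Data.Integer.Properties using (*-cancelˡ-≡; *-zeroʳ; *-zeroˡ; +-identityʳ; +-identityˡ; *-identityˡ; *-identityʳ; neg-involutive; ∣i∣≡0⇒i≡0; abs-*; i-j≡0⇒i≡j; pos-+; pos-*; +-injective; ∣-i∣≡∣i∣; i≡j⇒i-j≡0)
  open import Data.Integer.Tactic.RingSolver using (solve-∀)
  open ≡-Reasoning

  minor : ∀ {A : Set} {n} → Matrix A (suc n) → Fin (suc n) → Matrix A n
  minor M j r s = M (suc r) (punchIn j s)

  det-cong : ∀ {n} (M M′ : Matrix ℤ n) → (∀ r s → M r s ≡ M′ r s) → det M ≡ det M′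
  det-cong {zero}  M M′ M≈M′ = refl
  det-cong {suc n} M M′ M≈M′ = sum-cong-≗ λ j →
    cong (sign (toℕ j) *_) (cong₂ _*_ (M≈M′ zero j) (det-cong _ _ λ r s → M≈M′ (suc r) (punchIn j s)))

  -- The transposition of the neighbours `inject₁ p` and `suc p`.
  swap : ∀ {n} → Fin n → Fin (suc n) → Fin (suc n)
  swap zero    zero          = suc zero
  swap zero    (suc zero)    = zero
  swap zero    (suc (suc j)) = suc (suc j)
  swap (suc p) zero          = zero
  swap (suc p) (suc j)       = suc (swap p j)

  sum-swap : ∀ {n} (p : Fin n) (f : Fin (suc n) → ℤ) → sum (f ∘ swap p) ≡ sum f
  sum-swap zero f = exchange (f zero) (f (suc zero)) _
    where
    exchange : ∀ a b c → b + (a + c) ≡ a + (b + c)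
    exchange = solve-∀
  sum-swap (suc p) f = cong (f zero +_) (sum-swap p (f ∘ suc))

  -- What an adjacent swap does to the expansion at column j. If j is one of the two neighbours,
  -- deleting it leaves the same minor as deleting the other neighbour of the original, and only the
  -- sign changes. Otherwise the swap survives as a swap `p′` inside the minor.
  data SwapPunchIn : ∀ {n} → Fin n → Fin (suc n) → Set where
    moved : ∀ {n} {p : Fin n} {j} → sign (toℕ (swap p j)) ≡ - sign (toℕ j) →
            (∀ s → swap p (punchIn j s) ≡ punchIn (swap p j) s) → SwapPunchIn p j
    fixed : ∀ {n} {p : Fin (suc n)} {j} (p′ : Fin n) → sign (toℕ (swap p j)) ≡ sign (toℕ j) →
            (∀ s → swap p (punchIn j s) ≡ punchIn (swap p j) (swap p′ s)) → SwapPunchIn p j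

  swapPunchIn : ∀ {n} (p : Fin n) j → SwapPunchIn p j
  swapPunchIn zero zero = moved refl λ { zero → refl ; (suc s) → refl }
  swapPunchIn zero (suc zero) = moved refl λ { zero → refl ; (suc s) → refl }
  swapPunchIn {suc (suc n)} zero (suc (suc j)) =
    fixed zero refl λ { zero → refl ; (suc zero) → refl ; (suc (suc s)) → refl }
  swapPunchIn {suc n} (suc p) zero = fixed p refl λ s → refl
  swapPunchIn {suc n} (suc p) (suc j) with swapPunchIn p j
  ... | moved sgn h = moved (cong -_ sgn) λ { zero → refl ; (suc s) → cong suc (h s) }
  ... | fixed p′ sgn h = fixed (suc p′) (cong -_ sgn) λ { zero → refl ; (suc s) → cong suc (h s) }

  sum-neg : ∀ {n} (f : Fin n → ℤ) → sum (λ i → - f i) ≡ - sum f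
  sum-neg {zero}  f = refl
  sum-neg {suc n} f = trans (cong (λ x → - f zero + x) (sum-neg (f ∘ suc))) (neg-+ (f zero) _)
    where
    neg-+ : ∀ a b → - a + - b ≡ - (a + b)
    neg-+ = solve-∀

  -- Term j of the swapped expansion is minus term `swap p j` of the original. The minus comes from
  -- the position of the column in the `moved` case, and from induction on the minor in the `fixed`
  -- case.
  det-swap : ∀ {n} (p : Fin n) (M : Matrix ℤ (suc n)) → det (λ r s → M r (swap p s)) ≡ - det M
  det-swap {n} p M = begin
    sum (λ j → sign (toℕ j) * (M zero (swap p j) * det (minor (λ r s → M r (swap p s)) j)))
      ≡⟨ sum-cong-≗ term ⟩
    sum (λ j → - f (swap p j))
      ≡⟨ sum-swap p (λ j → - f j) ⟩
    sum (λ j → - f j)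
      ≡⟨ sum-neg f ⟩
    - sum f ∎
    where
    f : Fin (suc n) → ℤ
    f j = sign (toℕ j) * (M zero j * det (minor M j))
    lemma₁ : ∀ s a d → s * (a * d) ≡ - (- s * (a * d))
    lemma₁ = solve-∀
    lemma₂ : ∀ s a d → s * (a * - d) ≡ - (s * (a * d))
    lemma₂ = solve-∀
    term : ∀ j → sign (toℕ j) * (M zero (swap p j) * det (minor (λ r s → M r (swap p s)) j)) ≡ - f (swap p j)
    term j with swapPunchIn p j
    ... | moved sgn h rewrite sgn =
      trans (lemma₁ (sign (toℕ j)) (M zero (swap p j)) _)
        (cong (λ d → - (- sign (toℕ j) * (M zero (swap p j) * d)))
          (det-cong _ _ λ r s → cong (M (suc r)) (h s)))
    ... | fixed p′ sgn h rewrite sgn =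
      trans (cong (λ d → sign (toℕ j) * (M zero (swap p j) * d))
          (trans (det-cong _ _ λ r s → cong (M (suc r)) (h s)) (det-swap p′ (minor M (swap p j)))))
        (lemma₂ (sign (toℕ j)) (M zero (swap p j)) _)

  swap-inject₁ : ∀ {n} (j : Fin n) → swap j (inject₁ j) ≡ suc j
  swap-inject₁ zero    = refl
  swap-inject₁ (suc j) = cong suc (swap-inject₁ j)

  -- Swapping equal neighbours changes nothing, so det equals its own negative. A farther column is
  -- first swapped one place towards column 0, at the cost of a sign.
  det-repeated : ∀ {n} (j : Fin n) (M : Matrix ℤ (suc n)) → (∀ r → M r zero ≡ M r (suc j)) → det M ≡ 0ℤ
  det-repeated {suc n} = <-weakInduction _ adjacent step
    where
    i≡-i⇒i≡0 : ∀ {i} → i ≡ - i → i ≡ 0ℤ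
    i≡-i⇒i≡0 {ℤ.+ zero} _ = refl
    adjacent : ∀ M → (∀ r → M r zero ≡ M r (suc zero)) → det M ≡ 0ℤ
    adjacent M eq = i≡-i⇒i≡0 (trans (det-cong M _ pointwise) (det-swap zero M))
      where
      pointwise : ∀ r s → M r s ≡ M r (swap zero s)
      pointwise r zero          = eq r
      pointwise r (suc zero)    = sym (eq r)
      pointwise r (suc (suc s)) = refl
    step : ∀ j → (∀ M → (∀ r → M r zero ≡ M r (suc (inject₁ j))) → det M ≡ 0ℤ) →
           ∀ M → (∀ r → M r zero ≡ M r (suc (suc j))) → det M ≡ 0ℤ
    step j ih M eq = begin
      det M                                     ≡⟨ neg-involutive (det M) ⟨
      - - det M                                 ≡⟨ cong -_ (det-swap (suc j) M) ⟨
      - det (λ r s → M r (swap (suc j) s))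
        ≡⟨ cong -_ (ih (λ r s → M r (swap (suc j) s)) λ r → trans (eq r) (cong (M r ∘ suc) (sym (swap-inject₁ j)))) ⟩
      0ℤ                                        ∎

  -- Cramer's rule is needed for coordinate 0 alone, so only column 0 is ever replaced.
  withColumn₀ : ∀ {n} → Matrix ℤ (suc n) → (Fin (suc n) → ℤ) → Matrix ℤ (suc n)
  withColumn₀ M w r zero    = w r
  withColumn₀ M w r (suc s) = M r (suc s)

  det-linear : ∀ {n} (M : Matrix ℤ (suc n)) (a b : ℤ) (u w : Fin (suc n) → ℤ) →
               det (withColumn₀ M (λ r → a * u r + b * w r)) ≡
               a * det (withColumn₀ M u) + b * det (withColumn₀ M w)
  det-linear {n} M a b u w = begin
    sum (f v)                                     ≡⟨ sum-cong-≗ term ⟩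
    sum (λ j → a * f u j + b * f w j)             ≡⟨ ∑-distrib-+ (λ j → a * f u j) (λ j → b * f w j) ⟩
    sum (λ j → a * f u j) + sum (λ j → b * f w j) ≡⟨ cong₂ _+_ (*-distribˡ-sum a (f u)) (*-distribˡ-sum b (f w)) ⟨
    a * sum (f u) + b * sum (f w)                 ∎
    where
    v : Fin (suc n) → ℤ
    v r = a * u r + b * w r
    f : (Fin (suc n) → ℤ) → Fin (suc n) → ℤ
    f x j = sign (toℕ j) * (withColumn₀ M x zero j * det (minor (withColumn₀ M x) j))
    first : ∀ a b x y d → 1ℤ * ((a * x + b * y) * d) ≡ a * (1ℤ * (x * d)) + b * (1ℤ * (y * d))
    first = solve-∀
    later : ∀ a b s c x y → s * (c * (a * x + b * y)) ≡ a * (s * (c * x)) + b * (s * (c * y))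
    later = solve-∀
    term : ∀ j → f v j ≡ a * f u j + b * f w j
    term zero = first a b (u zero) (w zero) _
    -- The minor at a later column still has the replaced column as its own column 0, so induction
    -- applies to it.
    term (suc {suc n} j) = begin
      s * (c * det (minor (withColumn₀ M v) (suc j)))
        ≡⟨ cong (λ d → s * (c * d)) (trans (expose v) (trans
             (det-linear (minor M (suc j)) a b (u ∘ suc) (w ∘ suc))
             (cong₂ (λ x y → a * x + b * y) (sym (expose u)) (sym (expose w))))) ⟩
      s * (c * (a * det (minor (withColumn₀ M u) (suc j)) + b * det (minor (withColumn₀ M w) (suc j))))
        ≡⟨ later a b s c _ _ ⟩
      a * f u (suc j) + b * f w (suc j) ∎
      where
      s = sign (toℕ (suc j))
      c = M zero (suc j)
      expose : ∀ x → det (minor (withColumn₀ M x) (suc j)) ≡ det (withColumn₀ (minor M (suc j)) (x ∘ suc))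
      expose x = det-cong (minor (withColumn₀ M x) (suc j)) (withColumn₀ (minor M (suc j)) (x ∘ suc))
        λ { r zero → refl ; r (suc s) → refl }

  det-combination : ∀ {n k} (M : Matrix ℤ (suc n)) (c : Fin k → ℤ) (W : Fin (suc n) → Fin k → ℤ) →
                    det (withColumn₀ M (λ r → sum (λ i → c i * W r i))) ≡
                    sum (λ i → c i * det (withColumn₀ M (λ r → W r i)))
  det-combination {k = zero} M c W = begin
    det (withColumn₀ M (λ _ → 0ℤ))
      -- The zero column is a combination with both scalars 0, so linearity evaluates it.
      ≡⟨ det-linear M 0ℤ 0ℤ (λ _ → 0ℤ) (λ _ → 0ℤ) ⟩
    0ℤ ∎
  det-combination {n} {suc k} M c W = begin
    det (withColumn₀ M (λ r → c zero * W r zero + rest r))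
      ≡⟨ det-cong (withColumn₀ M (λ r → c zero * W r zero + rest r)) _ pointwise ⟩
    det (withColumn₀ M (λ r → c zero * W r zero + 1ℤ * rest r))
      ≡⟨ det-linear M (c zero) 1ℤ (λ r → W r zero) rest ⟩
    c zero * det (withColumn₀ M (λ r → W r zero)) + 1ℤ * det (withColumn₀ M rest)
      ≡⟨ cong (λ x → c zero * det (withColumn₀ M (λ r → W r zero)) + x)
           (trans (*-identityˡ _) (det-combination M (c ∘ suc) (λ r → W r ∘ suc))) ⟩
    sum (λ i → c i * det (withColumn₀ M (λ r → W r i))) ∎
    where
    rest : Fin (suc n) → ℤ
    rest r = sum (λ i → c (suc i) * W r (suc i))
    pointwise : ∀ r s → withColumn₀ M (λ r → c zero * W r zero + rest r) r s ≡
                        withColumn₀ M (λ r → c zero * W r zero + 1ℤ * rest r) r s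
    pointwise r zero    = cong (λ x → c zero * W r zero + x) (sym (*-identityˡ (rest r)))
    pointwise r (suc s) = refl

  sum-zero : ∀ {n} {f : Fin n → ℤ} → (∀ i → f i ≡ 0ℤ) → sum f ≡ 0ℤ
  sum-zero {n} f≡0 = trans (sum-cong-≗ f≡0) (sum-replicate-zero n)

  det-zeroColumn₀ : ∀ {n} (M : Matrix ℤ (suc n)) → (∀ r → M r zero ≡ 0ℤ) → det M ≡ 0ℤ
  det-zeroColumn₀ M eq = begin
    det M
      ≡⟨ det-cong M (withColumn₀ M (λ _ → 0ℤ)) (λ { r zero → eq r ; r (suc s) → refl }) ⟩
    det (withColumn₀ M (λ _ → 0ℤ)) ≡⟨ det-linear M 0ℤ 0ℤ (λ _ → 0ℤ) (λ _ → 0ℤ) ⟩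
    0ℤ                             ∎

  det-singleColumn₀ : ∀ {n} (M : Matrix ℤ (suc n)) → (∀ r → M (suc r) zero ≡ 0ℤ) →
                      det M ≡ M zero zero * det (minor M zero)
  det-singleColumn₀ {n} M eq = begin
    1ℤ * (M zero zero * det (minor M zero)) + sum rest
      ≡⟨ cong₂ _+_ (*-identityˡ (M zero zero * det (minor M zero))) (sum-zero vanish) ⟩
    M zero zero * det (minor M zero) + 0ℤ
      ≡⟨ +-identityʳ _ ⟩
    M zero zero * det (minor M zero) ∎
    where
    rest : Fin n → ℤ
    rest j = sign (toℕ (suc j)) * (M zero (suc j) * det (minor M (suc j)))
    annihilate : ∀ s a → s * (a * 0ℤ) ≡ 0ℤ
    annihilate = solve-∀
    zero-minor : ∀ {n} (M : Matrix ℤ (suc n)) j → (∀ r → M (suc r) zero ≡ 0ℤ) → det (minor M (suc j)) ≡ 0ℤ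
    zero-minor {suc n} M j eq = det-zeroColumn₀ (minor M (suc j)) eq
    vanish : ∀ j → rest j ≡ 0ℤ
    vanish j = trans (cong (λ d → sign (toℕ (suc j)) * (M zero (suc j) * d)) (zero-minor M j eq))
                     (annihilate (sign (toℕ (suc j))) (M zero (suc j)))

  -- Replace column 0 by Mc. By linearity the determinant becomes c₀ det M, as every other summand
  -- repeats a column; but the new column is t e₀, so expansion leaves t times the corner minor.
  cramer₀ : ∀ {n} (M : Matrix ℤ (suc n)) (c : Fin (suc n) → ℤ) (t : ℤ) →
            sum (λ i → c i * M zero i) ≡ t → (∀ r → sum (λ i → c i * M (suc r) i) ≡ 0ℤ) →
            c zero * det M ≡ t * det (minor M zero)
  cramer₀ {n} M c t eq₀ eq = begin
    c zero * det M
      ≡⟨ +-identityʳ _ ⟨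
    c zero * det M + 0ℤ
      ≡⟨ cong₂ _+_ (cong (c zero *_) (det-cong M (withColumn₀ M (λ r → M r zero))
                   λ { r zero → refl ; r (suc s) → refl })) (sym (sum-zero vanish)) ⟩
    sum (λ i → c i * det (withColumn₀ M (λ r → M r i)))
      ≡⟨ det-combination M c M ⟨
    det M′
      ≡⟨ det-singleColumn₀ M′ eq ⟩
    M′ zero zero * det (minor M zero)
      ≡⟨ cong (_* det (minor M zero)) eq₀ ⟩
    t * det (minor M zero) ∎
    where
    M′ = withColumn₀ M (λ r → sum (λ i → c i * M r i))
    vanish : ∀ i → c (suc i) * det (withColumn₀ M (λ r → M r (suc i))) ≡ 0ℤ
    vanish i = trans (cong (c (suc i) *_) (det-repeated i (withColumn₀ M (λ r → M r (suc i))) λ r → refl)) (*-zeroʳ (c (suc i)))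

  identity-suc : ∀ {n} (i j : Fin n) → identity (suc i) (suc j) ≡ identity i j
  identity-suc i j with i ≟ j
  ... | yes _ = refl
  ... | no  _ = refl

  sum-identity : ∀ {n} (k : Fin n) (f : Fin n → ℤ) → sum (λ i → f i * identity k i) ≡ f k
  sum-identity {suc n} zero f = begin
    f zero * 1ℤ + sum (λ i → f (suc i) * 0ℤ)
      ≡⟨ cong₂ _+_ (*-identityʳ (f zero)) (sum-zero λ i → *-zeroʳ (f (suc i))) ⟩
    f zero + 0ℤ                              ≡⟨ +-identityʳ (f zero) ⟩
    f zero                                   ∎
  sum-identity {suc n} (suc k) f = begin
    f zero * 0ℤ + sum (λ i → f (suc i) * identity (suc k) (suc i))
      ≡⟨ cong₂ _+_ (*-zeroʳ (f zero)) (sum-cong-≗ λ i → cong (f (suc i) *_) (identity-suc k i)) ⟩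
    0ℤ + sum (λ i → f (suc i) * identity k i)
      ≡⟨ +-identityˡ _ ⟩
    sum (λ i → f (suc i) * identity k i)
      ≡⟨ sum-identity k (f ∘ suc) ⟩
    f (suc k) ∎

  sum-const : ∀ n c → sum {n} (λ _ → c) ≡ ℤ.+ n * c
  sum-const zero    c = sym (*-zeroˡ c)
  sum-const (suc n) c = trans (cong (c +_) (sum-const n c)) (lemma c (ℤ.+ n))
    where
    lemma : ∀ c k → c + k * c ≡ (1ℤ + k) * c
    lemma = solve-∀

  -- Determinants of yI - 2J and of its bordered form

  spokesMatrix : ℤ → ∀ m → Matrix ℤ m
  spokesMatrix y m r s = y * identity r s - ℤ.+ 2

  -- In the step to m + 1, put a = y - 2(m + 1). Then c = a e₀ + 2·1 solves (yI - 2J) c = y a e₀ and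
  -- has c₀ = y - 2m, so Cramer's rule reduces to size m once c₀ is cancelled. The factor y on the
  -- left covers m = 0 without a quotient.
  det-spokesMatrix : ∀ y m → (∀ k → k ℕ.≤ m → y - ℤ.+ 2 * ℤ.+ k ≢ 0ℤ) →
                     y * det (spokesMatrix y m) ≡ y ^ m * (y - ℤ.+ 2 * ℤ.+ m)
  det-spokesMatrix y zero    _  = lemma y
    where
    lemma : ∀ y → y * 1ℤ ≡ 1ℤ * (y - ℤ.+ 2 * 0ℤ)
    lemma = solve-∀
  det-spokesMatrix y (suc m) y≢ = *-cancelˡ-≡ b _ _ {{≢-nonZero (y≢ m (ℕ.n≤1+n m))}} (begin
    b * (y * det M)                      ≡⟨ c₀-lemma y (ℤ.+ m) (det M) ⟩
    y * (c zero * det M)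
      ≡⟨ cong (y *_) (cramer₀ M c (y * a * 1ℤ) (rows zero) (λ r → trans (rows (suc r)) (*-zeroʳ (y * a)))) ⟩
    y * (y * a * 1ℤ * det (minor M zero))
      ≡⟨ cong (λ d → y * (y * a * 1ℤ * d)) (det-cong (minor M zero) (spokesMatrix y m) λ r s → cong (λ δ → y * δ - ℤ.+ 2) (identity-suc r s)) ⟩
    y * (y * a * 1ℤ * det (spokesMatrix y m)) ≡⟨ move y a (det (spokesMatrix y m)) ⟩
    y * a * (y * det (spokesMatrix y m))
      ≡⟨ cong (y * a *_) (det-spokesMatrix y m λ k k≤m → y≢ k (ℕ.m≤n⇒m≤1+n k≤m)) ⟩
    y * a * (y ^ m * b)                  ≡⟨ finish y a b (y ^ m) ⟩
    b * (y * y ^ m * a)                  ∎)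
    where
    M = spokesMatrix y (suc m)
    a = y - ℤ.+ 2 * ℤ.+ suc m
    b = y - ℤ.+ 2 * ℤ.+ m
    c : Fin (suc m) → ℤ
    c i = a * identity zero i + ℤ.+ 2
    c₀-lemma : ∀ y k d → (y - ℤ.+ 2 * k) * (y * d) ≡ y * (((y - ℤ.+ 2 * (1ℤ + k)) * 1ℤ + ℤ.+ 2) * d)
    c₀-lemma = solve-∀
    move : ∀ y a d → y * (y * a * 1ℤ * d) ≡ y * a * (y * d)
    move = solve-∀
    finish : ∀ y a b p → y * a * (p * b) ≡ b * (y * p * a)
    finish = solve-∀
    expand : ∀ y a δ₀ δ → (a * δ₀ + ℤ.+ 2) * (y * δ - ℤ.+ 2) ≡ a * (y * δ - ℤ.+ 2) * δ₀ + (ℤ.+ 2 * y * δ + - ℤ.+ 4)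
    expand = solve-∀
    collect : ∀ y k δ → (y - ℤ.+ 2 * k) * (y * δ - ℤ.+ 2) + (ℤ.+ 2 * y + k * - ℤ.+ 4) ≡ y * (y - ℤ.+ 2 * k) * δ
    collect = solve-∀
    rows : ∀ r → sum (λ i → c i * M r i) ≡ y * a * identity r zero
    rows r = begin
      sum (λ i → c i * M r i)
        ≡⟨ sum-cong-≗ (λ i → expand y a (identity zero i) (identity r i)) ⟩
      sum (λ i → f i * identity zero i + (ℤ.+ 2 * y * identity r i + - ℤ.+ 4))
        ≡⟨ ∑-distrib-+ (λ i → f i * identity zero i) (λ i → ℤ.+ 2 * y * identity r i + - ℤ.+ 4) ⟩
      sum (λ i → f i * identity zero i) + sum (λ i → ℤ.+ 2 * y * identity r i + - ℤ.+ 4)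
        ≡⟨ cong₂ _+_ (sum-identity zero f) (trans (∑-distrib-+ (λ i → ℤ.+ 2 * y * identity r i) (λ _ → - ℤ.+ 4))
             (cong₂ _+_ (sum-identity r (λ _ → ℤ.+ 2 * y)) (sum-const (suc m) (- ℤ.+ 4)))) ⟩
      f zero + (ℤ.+ 2 * y + ℤ.+ suc m * - ℤ.+ 4)
        ≡⟨ collect y (ℤ.+ suc m) (identity r zero) ⟩
      y * a * identity r zero ∎
      where
      f : Fin (suc m) → ℤ
      f i = a * (y * identity r i - ℤ.+ 2)

  bordered : ℤ → ∀ {m} → (Fin m → ℤ) → Matrix ℤ (suc m)
  bordered y v zero    zero    = y - ℤ.+ 3
  bordered y v zero    (suc s) = - v s
  bordered y v (suc r) zero    = - v r
  bordered y v (suc r) (suc s) = spokesMatrix y _ r s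

  -- Cramer's rule with `c` gives y a det = t det(yI - 2J). One more factor y turns the right side
  -- into t yᵐ a, and a cancels.
  det-bordered : ∀ y m (v : Fin m → ℤ) → (∀ k → k ℕ.≤ m → y - ℤ.+ 2 * ℤ.+ k ≢ 0ℤ) →
                 let a = y - ℤ.+ 2 * ℤ.+ m ; S₁ = sum v ; S₂ = sum (λ i → v i * v i) in
                 y * (y * det (bordered y v)) ≡ ((y - ℤ.+ 3) * (y * a) - a * S₂ - ℤ.+ 2 * (S₁ * S₁)) * y ^ m
  det-bordered y m v y≢ = *-cancelˡ-≡ a _ _ {{≢-nonZero (y≢ m ℕ.≤-refl)}} (begin
    a * (y * (y * det A))                 ≡⟨ move₁ a y (det A) ⟩
    y * (c zero * det A)                  ≡⟨ cong (y *_) (cramer₀ A c t row₀ rows) ⟩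
    y * (t * det (spokesMatrix y m))      ≡⟨ move₂ y t (det (spokesMatrix y m)) ⟩
    t * (y * det (spokesMatrix y m))      ≡⟨ cong (t *_) (det-spokesMatrix y m y≢) ⟩
    t * (y ^ m * a)                       ≡⟨ move₃ t (y ^ m) a ⟩
    a * (t * y ^ m)                       ∎)
    where
    A = bordered y v
    a = y - ℤ.+ 2 * ℤ.+ m
    S₁ = sum v
    S₂ = sum (λ i → v i * v i)
    t = (y - ℤ.+ 3) * (y * a) - a * S₂ - ℤ.+ 2 * (S₁ * S₁)
    c : Fin (suc m) → ℤ
    c zero    = y * a
    c (suc i) = a * v i + ℤ.+ 2 * S₁
    move₁ : ∀ a y d → a * (y * (y * d)) ≡ y * (y * a * d)
    move₁ = solve-∀
    move₂ : ∀ y t d → y * (t * d) ≡ t * (y * d)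
    move₂ = solve-∀
    move₃ : ∀ t p a → t * (p * a) ≡ a * (t * p)
    move₃ = solve-∀
    expand₀ : ∀ a s x → (a * x + ℤ.+ 2 * s) * - x ≡ - a * (x * x) + (- (ℤ.+ 2 * s)) * x
    expand₀ = solve-∀
    collect₀ : ∀ y a s₂ s → y * a * (y - ℤ.+ 3) + (- a * s₂ + (- (ℤ.+ 2 * s)) * s) ≡
               (y - ℤ.+ 3) * (y * a) - a * s₂ - ℤ.+ 2 * (s * s)
    collect₀ = solve-∀
    row₀ : sum (λ i → c i * A zero i) ≡ t
    row₀ = begin
      y * a * (y - ℤ.+ 3) + sum (λ i → (a * v i + ℤ.+ 2 * S₁) * - v i)
        ≡⟨ cong (λ x → y * a * (y - ℤ.+ 3) + x) (begin
          sum (λ i → (a * v i + ℤ.+ 2 * S₁) * - v i)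
            ≡⟨ sum-cong-≗ (λ i → expand₀ a S₁ (v i)) ⟩
          sum (λ i → - a * (v i * v i) + (- (ℤ.+ 2 * S₁)) * v i)
            ≡⟨ ∑-distrib-+ (λ i → - a * (v i * v i)) (λ i → (- (ℤ.+ 2 * S₁)) * v i) ⟩
          sum (λ i → - a * (v i * v i)) + sum (λ i → (- (ℤ.+ 2 * S₁)) * v i)
            ≡⟨ cong₂ _+_ (*-distribˡ-sum (- a) (λ i → v i * v i)) (*-distribˡ-sum (- (ℤ.+ 2 * S₁)) v) ⟨
          - a * S₂ + (- (ℤ.+ 2 * S₁)) * S₁ ∎) ⟩
      y * a * (y - ℤ.+ 3) + (- a * S₂ + (- (ℤ.+ 2 * S₁)) * S₁)
        ≡⟨ collect₀ y a S₂ S₁ ⟩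
      t ∎
    expand : ∀ y a s x δ → (a * x + ℤ.+ 2 * s) * (y * δ - ℤ.+ 2) ≡
                           (a * x + ℤ.+ 2 * s) * y * δ + (- (ℤ.+ 2 * a) * x + - (ℤ.+ 4 * s))
    expand = solve-∀
    collect : ∀ y k s x → y * (y - ℤ.+ 2 * k) * - x +
              (((y - ℤ.+ 2 * k) * x + ℤ.+ 2 * s) * y + (- (ℤ.+ 2 * (y - ℤ.+ 2 * k)) * s + k * - (ℤ.+ 4 * s))) ≡ 0ℤ
    collect = solve-∀
    rows : ∀ r → sum (λ i → c i * A (suc r) i) ≡ 0ℤ
    rows r = begin
      y * a * - v r + sum (λ i → c (suc i) * (y * identity r i - ℤ.+ 2))
        ≡⟨ cong (λ x → y * a * - v r + x) (begin
          sum (λ i → c (suc i) * (y * identity r i - ℤ.+ 2))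
            ≡⟨ sum-cong-≗ (λ i → expand y a S₁ (v i) (identity r i)) ⟩
          sum (λ i → f i * identity r i + (b * v i + - (ℤ.+ 4 * S₁)))
            ≡⟨ ∑-distrib-+ (λ i → f i * identity r i) (λ i → b * v i + - (ℤ.+ 4 * S₁)) ⟩
          sum (λ i → f i * identity r i) + sum (λ i → b * v i + - (ℤ.+ 4 * S₁))
            ≡⟨ cong₂ _+_ (sum-identity r f) (trans (∑-distrib-+ (λ i → b * v i) (λ _ → - (ℤ.+ 4 * S₁)))
                 (cong₂ _+_ (sym (*-distribˡ-sum b v)) (sum-const m (- (ℤ.+ 4 * S₁))))) ⟩
          f r + (b * S₁ + ℤ.+ m * - (ℤ.+ 4 * S₁)) ∎) ⟩
      y * a * - v r + (f r + (b * S₁ + ℤ.+ m * - (ℤ.+ 4 * S₁)))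
        ≡⟨ collect y (ℤ.+ m) S₁ (v r) ⟩
      0ℤ ∎
      where
      b = - (ℤ.+ 2 * a)
      f : Fin m → ℤ
      f i = (a * v i + ℤ.+ 2 * S₁) * y

  -- Evaluation and coefficients of polynomials

  eval : ℤ → Poly → ℤ
  eval z []      = 0ℤ
  eval z (a ∷ p) = a + z * eval z p

  eval-+ : ∀ z p q → eval z (p +ₚ q) ≡ eval z p + eval z q
  eval-+ z []      q       = sym (+-identityˡ _)
  eval-+ z (a ∷ p) []      = sym (+-identityʳ _)
  eval-+ z (a ∷ p) (b ∷ q) = trans (cong (λ e → a + b + z * e) (eval-+ z p q)) (lemma a b z (eval z p) (eval z q))
    where
    lemma : ∀ a b z p q → a + b + z * (p + q) ≡ a + z * p + (b + z * q)
    lemma = solve-∀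

  eval-neg : ∀ z p → eval z (-ₚ p) ≡ - eval z p
  eval-neg z []      = refl
  eval-neg z (a ∷ p) = trans (cong (λ e → - a + z * e) (eval-neg z p)) (lemma a z (eval z p))
    where
    lemma : ∀ a z p → - a + z * - p ≡ - (a + z * p)
    lemma = solve-∀

  eval-map-* : ∀ z b p → eval z (List.map (b *_) p) ≡ b * eval z p
  eval-map-* z b []      = sym (*-zeroʳ b)
  eval-map-* z b (a ∷ p) = trans (cong (λ e → b * a + z * e) (eval-map-* z b p)) (lemma a b z (eval z p))
    where
    lemma : ∀ a b z p → b * a + z * (b * p) ≡ b * (a + z * p)
    lemma = solve-∀

  eval-* : ∀ z p q → eval z (p *ₚ q) ≡ eval z p * eval z q
  eval-* z []      q = sym (*-zeroˡ (eval z q))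
  eval-* z (a ∷ p) q = begin
    eval z (List.map (a *_) q +ₚ (0ℤ ∷ (p *ₚ q)))
      ≡⟨ eval-+ z (List.map (a *_) q) (0ℤ ∷ (p *ₚ q)) ⟩
    eval z (List.map (a *_) q) + (0ℤ + z * eval z (p *ₚ q))
      ≡⟨ cong₂ (λ x y → x + (0ℤ + z * y)) (eval-map-* z a q) (eval-* z p q) ⟩
    a * eval z q + (0ℤ + z * (eval z p * eval z q))
      ≡⟨ lemma a z (eval z p) (eval z q) ⟩
    (a + z * eval z p) * eval z q ∎
    where
    lemma : ∀ a z p q → a * q + (0ℤ + z * (p * q)) ≡ (a + z * p) * q
    lemma = solve-∀

  eval-sum : ∀ z {n} (f : Fin n → Poly) → eval z (sumₚ f) ≡ sum (eval z ∘ f)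
  eval-sum z {zero}  f = refl
  eval-sum z {suc n} f = trans (eval-+ z (f zero) (sumₚ (f ∘ suc))) (cong (λ x → eval z (f zero) + x) (eval-sum z (f ∘ suc)))

  eval-one : ∀ z → eval z (constant 1ℤ) ≡ 1ℤ
  eval-one z = cong (1ℤ +_) (*-zeroʳ z)

  eval-sign : ∀ z k → eval z (Det[X].sign k) ≡ sign k
  eval-sign z zero    = eval-one z
  eval-sign z (suc k) = trans (eval-neg z (Det[X].sign k)) (cong -_ (eval-sign z k))

  -- This carries the determinant from coefficient lists to ℤ, where linearity and Cramer's rule are
  -- available.
  eval-det : ∀ z {n} (M : Matrix Poly n) → eval z (Det[X].det M) ≡ det (λ r s → eval z (M r s))
  eval-det z {zero}  M = eval-one z
  eval-det z {suc n} M = trans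
    (eval-sum z (λ j → Det[X].sign (toℕ j) *ₚ (M zero j *ₚ Det[X].det (minor M j))))
    (sum-cong-≗ λ j → trans
      (eval-* z (Det[X].sign (toℕ j)) (M zero j *ₚ Det[X].det (minor M j)))
      (cong₂ _*_ (eval-sign z (toℕ j))
        (trans (eval-* z (M zero j) (Det[X].det (minor M j)))
          (cong (eval z (M zero j) *_) (eval-det z (minor M j))))))

  eval-identity : ∀ z {n} (i j : Fin n) → eval z (Det[X].identity i j) ≡ identity i j
  eval-identity z i j with i ≟ j
  ... | yes _ = eval-one z
  ... | no  _ = refl

  eval-charPoly : ∀ z {n} (M : Matrix ℤ n) → eval z (charPoly M) ≡ det (λ i j → z * identity i j - M i j)
  eval-charPoly z M = trans (eval-det z (λ i j → X *ₚ Det[X].identity i j +ₚ -ₚ constant (M i j)))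
    (det-cong _ (λ i j → z * identity i j - M i j) λ i j → begin
      eval z (X *ₚ Det[X].identity i j +ₚ -ₚ constant (M i j))
        ≡⟨ eval-+ z (X *ₚ Det[X].identity i j) (-ₚ constant (M i j)) ⟩
      eval z (X *ₚ Det[X].identity i j) + eval z (-ₚ constant (M i j))
        ≡⟨ cong (_+ eval z (-ₚ constant (M i j))) (eval-* z X (Det[X].identity i j)) ⟩
      eval z X * eval z (Det[X].identity i j) + (- M i j + z * 0ℤ)
        ≡⟨ cong (λ x → eval z X * x + (- M i j + z * 0ℤ)) (eval-identity z i j) ⟩
      eval z X * identity i j + (- M i j + z * 0ℤ)
        ≡⟨ lemma z (identity i j) (M i j) ⟩
      z * identity i j - M i j ∎)
    where
    lemma : ∀ z x m → (0ℤ + z * (1ℤ + z * 0ℤ)) * x + (- m + z * 0ℤ) ≡ z * x - m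
    lemma = solve-∀

  coeff-+ : ∀ p q k → coeff (p +ₚ q) k ≡ coeff p k + coeff q k
  coeff-+ []      q       k       = sym (+-identityˡ _)
  coeff-+ (a ∷ p) []      k       = sym (+-identityʳ _)
  coeff-+ (a ∷ p) (b ∷ q) zero    = refl
  coeff-+ (a ∷ p) (b ∷ q) (suc k) = coeff-+ p q k

  coeff-neg : ∀ p k → coeff (-ₚ p) k ≡ - coeff p k
  coeff-neg []      k       = refl
  coeff-neg (a ∷ p) zero    = refl
  coeff-neg (a ∷ p) (suc k) = coeff-neg p k

  -- The constant term is a multiple of every large z, hence zero.
  eventually-zero⇒coeff≡0 : ∀ p z₀ → (∀ z → z₀ ℕ.≤ z → eval (ℤ.+ z) p ≡ 0ℤ) → ∀ k → coeff p k ≡ 0ℤ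
  eventually-zero⇒coeff≡0 []      z₀ vanishes k = refl
  eventually-zero⇒coeff≡0 (a ∷ p) z₀ vanishes = coefficients
    where
    z = suc ∣ a ∣ ℕ.+ z₀
    isolate : ∀ a b → a ≡ - b + (a + b)
    isolate = solve-∀
    ∣a∣≡ : ∣ a ∣ ≡ z ℕ.* ∣ eval (ℤ.+ z) p ∣
    ∣a∣≡ = begin
      ∣ a ∣
        ≡⟨ cong ∣_∣ (isolate a (ℤ.+ z * eval (ℤ.+ z) p)) ⟩
      ∣ - (ℤ.+ z * eval (ℤ.+ z) p) + eval (ℤ.+ z) (a ∷ p) ∣
        ≡⟨ cong (λ x → ∣ - (ℤ.+ z * eval (ℤ.+ z) p) + x ∣) (vanishes z (ℕ.m≤n+m z₀ (suc ∣ a ∣))) ⟩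
      ∣ - (ℤ.+ z * eval (ℤ.+ z) p) + 0ℤ ∣
        ≡⟨ cong ∣_∣ (+-identityʳ (- (ℤ.+ z * eval (ℤ.+ z) p))) ⟩
      ∣ - (ℤ.+ z * eval (ℤ.+ z) p) ∣
        ≡⟨ ∣-i∣≡∣i∣ (ℤ.+ z * eval (ℤ.+ z) p) ⟩
      ∣ ℤ.+ z * eval (ℤ.+ z) p ∣
        ≡⟨ abs-* (ℤ.+ z) (eval (ℤ.+ z) p) ⟩
      z ℕ.* ∣ eval (ℤ.+ z) p ∣ ∎
    small-multiple : ∀ {n z} w → n ≡ z ℕ.* w → n ℕ.< z → n ≡ 0
    small-multiple {z = z} zero    eq _   = trans eq (ℕ.*-zeroʳ z)
    small-multiple {z = z} (suc w) eq n<z =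
      contradiction (subst (z ℕ.≤_) (sym eq) (ℕ.m≤m*n z (suc w))) (ℕ.<⇒≱ n<z)
    a≡0 : a ≡ 0ℤ
    a≡0 = ∣i∣≡0⇒i≡0 (small-multiple ∣ eval (ℤ.+ z) p ∣ ∣a∣≡ (ℕ.m≤m+n (suc ∣ a ∣) z₀))
    -- Raising the bound to `suc z₀` makes z nonzero, so that it cancels from z · p(z) = 0.
    tail-vanishes : ∀ z → suc z₀ ℕ.≤ z → eval (ℤ.+ z) p ≡ 0ℤ
    tail-vanishes z@(suc _) z₀<z = *-cancelˡ-≡ (ℤ.+ z) _ _ (begin
      ℤ.+ z * eval (ℤ.+ z) p      ≡⟨ +-identityˡ _ ⟨
      0ℤ + ℤ.+ z * eval (ℤ.+ z) p ≡⟨ cong (_+ ℤ.+ z * eval (ℤ.+ z) p) a≡0 ⟨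
      eval (ℤ.+ z) (a ∷ p)        ≡⟨ vanishes z (ℕ.<⇒≤ z₀<z) ⟩
      0ℤ                          ≡⟨ *-zeroʳ (ℤ.+ z) ⟨
      ℤ.+ z * 0ℤ                  ∎)
    coefficients : ∀ k → coeff (a ∷ p) k ≡ 0ℤ
    coefficients zero    = a≡0
    coefficients (suc k) = eventually-zero⇒coeff≡0 p (suc z₀) tail-vanishes k

  eventually-equal⇒coeff≡ : ∀ p q z₀ → (∀ z → z₀ ℕ.≤ z → eval (ℤ.+ z) p ≡ eval (ℤ.+ z) q) →
                            ∀ k → coeff p k ≡ coeff q k
  eventually-equal⇒coeff≡ p q z₀ equal k = i-j≡0⇒i≡j (coeff p k) (coeff q k) (begin
    coeff p k - coeff q k         ≡⟨ cong (λ x → coeff p k + x) (coeff-neg q k) ⟨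
    coeff p k + coeff (-ₚ q) k    ≡⟨ coeff-+ p (-ₚ q) k ⟨
    coeff (p +ₚ -ₚ q) k           ≡⟨ eventually-zero⇒coeff≡0 (p +ₚ -ₚ q) z₀ difference k ⟩
    0ℤ                            ∎)
    where
    difference : ∀ z → z₀ ℕ.≤ z → eval (ℤ.+ z) (p +ₚ -ₚ q) ≡ 0ℤ
    difference z z₀≤z = begin
      eval (ℤ.+ z) (p +ₚ -ₚ q)             ≡⟨ eval-+ (ℤ.+ z) p (-ₚ q) ⟩
      eval (ℤ.+ z) p + eval (ℤ.+ z) (-ₚ q) ≡⟨ cong (λ x → eval (ℤ.+ z) p + x) (eval-neg (ℤ.+ z) q) ⟩
      eval (ℤ.+ z) p - eval (ℤ.+ z) q      ≡⟨ i≡j⇒i-j≡0 (equal z z₀≤z) ⟩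
      0ℤ                                   ∎

  -- Multiplication by 1 + X as shift-and-add makes the coefficients obey Pascal's rule directly.
  [1+X]^_*ₚ_ : ℕ → Poly → Poly
  [1+X]^ zero  *ₚ p = p
  [1+X]^ suc n *ₚ p = ([1+X]^ n *ₚ p) +ₚ (0ℤ ∷ [1+X]^ n *ₚ p)

  eval-[1+X]^ : ∀ z n p → eval z ([1+X]^ n *ₚ p) ≡ (z + 1ℤ) ^ n * eval z p
  eval-[1+X]^ z zero    p = sym (*-identityˡ _)
  eval-[1+X]^ z (suc n) p = begin
    eval z (([1+X]^ n *ₚ p) +ₚ (0ℤ ∷ [1+X]^ n *ₚ p))
      ≡⟨ eval-+ z ([1+X]^ n *ₚ p) (0ℤ ∷ [1+X]^ n *ₚ p) ⟩
    eval z ([1+X]^ n *ₚ p) + (0ℤ + z * eval z ([1+X]^ n *ₚ p))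
      ≡⟨ cong (λ x → x + (0ℤ + z * x)) (eval-[1+X]^ z n p) ⟩
    (z + 1ℤ) ^ n * eval z p + (0ℤ + z * ((z + 1ℤ) ^ n * eval z p))
      ≡⟨ lemma z ((z + 1ℤ) ^ n) (eval z p) ⟩
    (z + 1ℤ) * (z + 1ℤ) ^ n * eval z p ∎
    where
    lemma : ∀ z y p → y * p + (0ℤ + z * (y * p)) ≡ (z + 1ℤ) * y * p
    lemma = solve-∀

  -- The sum of pᵢ C(n, k - i) over i ≤ k, which is the k-th coefficient of (1 + X)ⁿ p.
  binomialConvolution : ℕ → Poly → ℕ → ℤ
  binomialConvolution n []      k       = 0ℤ
  binomialConvolution n (a ∷ p) zero    = a * ℤ.+ (n C 0)
  binomialConvolution n (a ∷ p) (suc k) = a * ℤ.+ (n C suc k) + binomialConvolution n p k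

  nC0≡1 : ∀ n → n C 0 ≡ 1
  nC0≡1 n = trans (nCk≡nC[n∸k] {k = 0} {n = n} ℕ.z≤n) (nCn≡1 n)

  convolution-pascal₀ : ∀ n p → binomialConvolution (suc n) p 0 ≡ binomialConvolution n p 0
  convolution-pascal₀ n []      = refl
  convolution-pascal₀ n (a ∷ p) = cong (λ c → a * ℤ.+ c) (trans (nC0≡1 (suc n)) (sym (nC0≡1 n)))

  convolution-pascal : ∀ n p k → binomialConvolution (suc n) p (suc k) ≡
                                 binomialConvolution n p (suc k) + binomialConvolution n p k
  convolution-pascal n []      k = refl
  convolution-pascal n (a ∷ p) k rewrite sym (nCk+nC[k+1]≡[n+1]C[k+1] n k) | pos-+ (n C k) (n C suc k) = by k
    where
    first : ∀ a x y b → a * (x + y) + b ≡ a * y + b + a * x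
    first = solve-∀
    later : ∀ a x y b c → a * (x + y) + (b + c) ≡ a * y + b + (a * x + c)
    later = solve-∀
    -- The head term splits by Pascal's rule for every k; at k = 0 the tail is read at index 0,
    -- where nothing lies below it to add.
    by : ∀ k → a * (ℤ.+ (n C k) + ℤ.+ (n C suc k)) + binomialConvolution (suc n) p k ≡
               binomialConvolution n (a ∷ p) (suc k) + binomialConvolution n (a ∷ p) k
    by zero    rewrite convolution-pascal₀ n p   = first a (ℤ.+ (n C 0)) (ℤ.+ (n C 1)) _
    by (suc k) rewrite convolution-pascal n p k  = later a (ℤ.+ (n C suc k)) (ℤ.+ (n C suc (suc k))) _ _

  coeff-[1+X]^ : ∀ n p k → coeff ([1+X]^ n *ₚ p) k ≡ binomialConvolution n p k
  coeff-[1+X]^ zero    []      k       = refl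
  coeff-[1+X]^ zero    (a ∷ p) zero    = sym (*-identityʳ a)
  coeff-[1+X]^ zero    (a ∷ p) (suc k) = begin
    coeff p k                                          ≡⟨ coeff-[1+X]^ zero p k ⟩
    binomialConvolution 0 p k                          ≡⟨ +-identityˡ _ ⟨
    0ℤ + binomialConvolution 0 p k                     ≡⟨ cong (_+ binomialConvolution 0 p k) (*-zeroʳ a) ⟨
    a * ℤ.+ (0 C suc k) + binomialConvolution 0 p k    ∎
  coeff-[1+X]^ (suc n) p zero = begin
    coeff ([1+X]^ suc n *ₚ p) 0        ≡⟨ coeff-+ ([1+X]^ n *ₚ p) _ 0 ⟩
    coeff ([1+X]^ n *ₚ p) 0 + 0ℤ       ≡⟨ +-identityʳ _ ⟩
    coeff ([1+X]^ n *ₚ p) 0            ≡⟨ coeff-[1+X]^ n p 0 ⟩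
    binomialConvolution n p 0          ≡⟨ convolution-pascal₀ n p ⟨
    binomialConvolution (suc n) p 0    ∎
  coeff-[1+X]^ (suc n) p (suc k) = begin
    coeff ([1+X]^ suc n *ₚ p) (suc k)
      ≡⟨ coeff-+ ([1+X]^ n *ₚ p) _ (suc k) ⟩
    coeff ([1+X]^ n *ₚ p) (suc k) + coeff ([1+X]^ n *ₚ p) k
      ≡⟨ cong₂ _+_ (coeff-[1+X]^ n p (suc k)) (coeff-[1+X]^ n p k) ⟩
    binomialConvolution n p (suc k) + binomialConvolution n p k
      ≡⟨ convolution-pascal n p k ⟨
    binomialConvolution (suc n) p (suc k) ∎

  -- The characteristic polynomial

  border : ∀ {m} → Fin m → Fin m → Fin m → ℤ
  border p q k = ℤ.+ 3 - identity p k - identity q k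

  sum-deltas : ∀ {m} (p q : Fin m) a b → sum (λ k → a + (b * identity p k + b * identity q k)) ≡ ℤ.+ m * a + (b + b)
  sum-deltas {m} p q a b = begin
    sum (λ k → a + (b * identity p k + b * identity q k))
      ≡⟨ ∑-distrib-+ (λ _ → a) (λ k → b * identity p k + b * identity q k) ⟩
    sum {m} (λ _ → a) + sum (λ k → b * identity p k + b * identity q k)
      ≡⟨ cong₂ _+_ (sum-const m a) (trans (∑-distrib-+ (λ k → b * identity p k) (λ k → b * identity q k))
          (cong₂ _+_ (sum-identity p (λ _ → b)) (sum-identity q (λ _ → b)))) ⟩
    ℤ.+ m * a + (b + b) ∎

  sum-border : ∀ {m} (p q : Fin m) → sum (border p q) ≡ ℤ.+ 3 * ℤ.+ m - ℤ.+ 2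
  sum-border {m} p q = begin
    sum (border p q)
      ≡⟨ sum-cong-≗ (λ k → expand (identity p k) (identity q k)) ⟩
    sum (λ k → ℤ.+ 3 + (- 1ℤ * identity p k + - 1ℤ * identity q k))   ≡⟨ sum-deltas p q (ℤ.+ 3) (- 1ℤ) ⟩
    ℤ.+ m * ℤ.+ 3 + (- 1ℤ + - 1ℤ)                                     ≡⟨ collect (ℤ.+ m) ⟩
    ℤ.+ 3 * ℤ.+ m - ℤ.+ 2                                             ∎
    where
    expand : ∀ x y → ℤ.+ 3 - x - y ≡ ℤ.+ 3 + (- 1ℤ * x + - 1ℤ * y)
    expand = solve-∀
    collect : ∀ k → k * ℤ.+ 3 + (- 1ℤ + - 1ℤ) ≡ ℤ.+ 3 * k - ℤ.+ 2
    collect = solve-∀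

  -- As p and q differ, the entries are 2 at these two places and 3 elsewhere, so a square is 9 with
  -- 5 taken off at p and at q.
  sum-border² : ∀ {m} (p q : Fin m) → p ≢ q → sum (λ k → border p q k * border p q k) ≡ ℤ.+ 9 * ℤ.+ m - ℤ.+ 10
  sum-border² {m} p q p≢q = begin
    sum (λ k → border p q k * border p q k)                              ≡⟨ sum-cong-≗ expand ⟩
    sum (λ k → ℤ.+ 9 + (- ℤ.+ 5 * identity p k + - ℤ.+ 5 * identity q k)) ≡⟨ sum-deltas p q (ℤ.+ 9) (- ℤ.+ 5) ⟩
    ℤ.+ m * ℤ.+ 9 + (- ℤ.+ 5 + - ℤ.+ 5)                                  ≡⟨ collect (ℤ.+ m) ⟩
    ℤ.+ 9 * ℤ.+ m - ℤ.+ 10                                               ∎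
    where
    expand : ∀ k → border p q k * border p q k ≡ ℤ.+ 9 + (- ℤ.+ 5 * identity p k + - ℤ.+ 5 * identity q k)
    expand k with p ≟ k | q ≟ k
    ... | yes refl | yes q≡p = contradiction (sym q≡p) p≢q
    ... | yes _    | no _    = refl
    ... | no _     | yes _   = refl
    ... | no _     | no _    = refl
    collect : ∀ k → k * ℤ.+ 9 + (- ℤ.+ 5 + - ℤ.+ 5) ≡ ℤ.+ 9 * k - ℤ.+ 10
    collect = solve-∀

  cubic : ℕ → Poly
  cubic m = - ℤ.+ m ∷ - (ℤ.+ 7 * (ℤ.+ m - 1ℤ)) ∷ - (ℤ.+ 2 * ℤ.+ m) ∷ 1ℤ ∷ []

  -- The interface between the two halves: the linear algebra uses only these entries, and the
  -- Steiner distances supply them.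
  record IsStarMatrix {m} (M : Matrix ℤ (suc m)) (p q : Fin m) : Set where
    field
      corner : M zero zero ≡ ℤ.+ 2
      row    : ∀ s → M zero (suc s) ≡ border p q s
      column : ∀ r → M (suc r) zero ≡ border p q r
      spokes : ∀ r s → M (suc r) (suc s) ≡ ℤ.+ 2 - identity r s

  -- The left side is the factor t of `det-bordered`. Its terms in m² cancel: 2m · 9m from a s₂
  -- against 2 (3m)² from s₁.
  cubic-value : ∀ x m s₁ s₂ → s₁ ≡ ℤ.+ 3 * m - ℤ.+ 2 → s₂ ≡ ℤ.+ 9 * m - ℤ.+ 10 →
    let y = x + 1ℤ ; a = y - ℤ.+ 2 * m in
    (y - ℤ.+ 3) * (y * a) - a * s₂ - ℤ.+ 2 * (s₁ * s₁) ≡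
    - m + x * (- (ℤ.+ 7 * (m - 1ℤ)) + x * (- (ℤ.+ 2 * m) + x * (1ℤ + x * 0ℤ)))
  cubic-value x m _ _ refl refl = lemma x m
    where
    lemma : ∀ x m → let y = x + 1ℤ ; a = y - ℤ.+ 2 * m ; s = ℤ.+ 3 * m - ℤ.+ 2 in
      (y - ℤ.+ 3) * (y * a) - a * (ℤ.+ 9 * m - ℤ.+ 10) - ℤ.+ 2 * (s * s) ≡
      - m + x * (- (ℤ.+ 7 * (m - 1ℤ)) + x * (- (ℤ.+ 2 * m) + x * (1ℤ + x * 0ℤ)))
    lemma = solve-∀

  -- The two factors y in `det-bordered` use up two of the m = N + 2 factors of yᵐ.
  det-starMatrix : ∀ x {m} (p q : Fin m) → p ≢ q →
    (∀ k → k ℕ.≤ m → x + 1ℤ - ℤ.+ 2 * ℤ.+ k ≢ 0ℤ) →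
    ∀ N → m ≡ suc (suc N) → det (bordered (x + 1ℤ) (border p q)) ≡ (x + 1ℤ) ^ N * eval x (cubic m)
  det-starMatrix x {m} p q p≢q y≢ N m≡2+N =
    *-cancelˡ-≡ y _ _ {{≢-nonZero y≢0}} (*-cancelˡ-≡ y _ _ {{≢-nonZero y≢0}} (begin
    y * (y * det (bordered y v))           ≡⟨ det-bordered y m v y≢ ⟩
    t * y ^ m
      ≡⟨ cong₂ _*_ (cubic-value x (ℤ.+ m) (sum v) (sum (λ i → v i * v i)) (sum-border p q) (sum-border² p q p≢q)) (cong (y ^_) m≡2+N) ⟩
    eval x (cubic m) * (y * (y * y ^ N))   ≡⟨ move (eval x (cubic m)) y (y ^ N) ⟩
    y * (y * (y ^ N * eval x (cubic m)))   ∎))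
    where
    y = x + 1ℤ
    v = border p q
    a = y - ℤ.+ 2 * ℤ.+ m
    t = (y - ℤ.+ 3) * (y * a) - a * sum (λ i → v i * v i) - ℤ.+ 2 * (sum v * sum v)
    y≢0 : y ≢ 0ℤ
    y≢0 y≡0 = y≢ 0 ℕ.z≤n (trans (+-identityʳ y) y≡0)
    move : ∀ e y w → e * (y * (y * w)) ≡ y * (y * (w * e))
    move = solve-∀

  charMatrix-bordered : ∀ x {m} {M : Matrix ℤ (suc m)} {p q} → IsStarMatrix M p q →
                        ∀ i j → x * identity i j - M i j ≡ bordered (x + 1ℤ) (border p q) i j
  charMatrix-bordered x {M = M} {p} {q} isStar = entries
    where
    open IsStarMatrix isStar
    corner-lemma : ∀ x → x * 1ℤ - ℤ.+ 2 ≡ x + 1ℤ - ℤ.+ 3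
    corner-lemma = solve-∀
    border-lemma : ∀ x w → x * 0ℤ - w ≡ - w
    border-lemma = solve-∀
    spokes-lemma : ∀ x δ → x * δ - (ℤ.+ 2 - δ) ≡ (x + 1ℤ) * δ - ℤ.+ 2
    spokes-lemma = solve-∀
    entries : ∀ i j → x * identity i j - M i j ≡ bordered (x + 1ℤ) (border p q) i j
    entries zero    zero    = trans (cong (λ e → x * 1ℤ - e) corner) (corner-lemma x)
    entries zero    (suc s) = trans (cong (λ e → x * 0ℤ - e) (row s)) (border-lemma x (border p q s))
    entries (suc r) zero    = trans (cong (λ e → x * 0ℤ - e) (column r)) (border-lemma x (border p q r))
    entries (suc r) (suc s) = trans
      (cong₂ (λ δ e → x * δ - e) (identity-suc r s) (spokes r s))
      (spokes-lemma x (identity r s))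

  coeff-charPoly : ∀ {m} {M : Matrix ℤ (suc m)} {p q} → p ≢ q → IsStarMatrix M p q →
                   ∀ N → m ≡ suc (suc N) → ∀ k → coeff (charPoly M) k ≡ binomialConvolution N (cubic m) k
  coeff-charPoly {m} {M} {p} {q} p≢q isStar N m≡2+N k = trans
    (eventually-equal⇒coeff≡ (charPoly M) ([1+X]^ N *ₚ cubic m) (2 ℕ.* m) (λ z 2m≤z → equal (ℤ.+ z) (large z 2m≤z)) k)
    (coeff-[1+X]^ N (cubic m) k)
    where
    -- A zero would give z + 1 = 2k ≤ 2m ≤ z.
    large : ∀ z → 2 ℕ.* m ℕ.≤ z → ∀ k → k ℕ.≤ m → ℤ.+ z + 1ℤ - ℤ.+ 2 * ℤ.+ k ≢ 0ℤ
    large z 2m≤z k k≤m eq = ℕ.<⇒≱ (ℕ.≤-reflexive (ℕ.+-comm 1 z)) (ℕ.≤-trans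
      (ℕ.≤-reflexive (+-injective (trans (i-j≡0⇒i≡j (ℤ.+ z + 1ℤ) (ℤ.+ 2 * ℤ.+ k) eq) (sym (pos-* 2 k)))))
      (ℕ.≤-trans (ℕ.*-monoʳ-≤ 2 k≤m) 2m≤z))
    equal : ∀ x → (∀ k → k ℕ.≤ m → x + 1ℤ - ℤ.+ 2 * ℤ.+ k ≢ 0ℤ) →
            eval x (charPoly M) ≡ eval x ([1+X]^ N *ₚ cubic m)
    equal x y≢ = begin
      eval x (charPoly M)                      ≡⟨ eval-charPoly x M ⟩
      det (λ i j → x * identity i j - M i j)
        ≡⟨ det-cong _ (bordered (x + 1ℤ) (border p q)) (charMatrix-bordered x isStar) ⟩
      det (bordered (x + 1ℤ) (border p q))     ≡⟨ det-starMatrix x p q p≢q y≢ N m≡2+N ⟩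
      (x + 1ℤ) ^ N * eval x (cubic m)          ≡⟨ eval-[1+X]^ x N (cubic m) ⟨
      eval x ([1+X]^ N *ₚ cubic m)             ∎

-- Steiner distances in a star

lookup-injective : ∀ {A : Set} {xs : List A} → Unique xs → ∀ {i j} → lookup xs i ≡ lookup xs j → i ≡ j
lookup-injective (_  ∷ _) {zero}  {zero}  eq = refl
lookup-injective (x∉ ∷ _) {zero}  {suc j} eq = contradiction eq (All.lookup x∉ (∈-lookup j))
lookup-injective (x∉ ∷ _) {suc i} {zero}  eq = contradiction (sym eq) (All.lookup x∉ (∈-lookup i))
lookup-injective (_  ∷ u) {suc i} {suc j} eq = cong suc (lookup-injective u eq)

-- Pigeonhole on positions in `ys`. It bounds the size of a subtree below by the number of edges it
-- is forced to contain.
length-mono-∈ : ∀ {A : Set} {xs ys : List A} → Unique xs → (∀ {x} → x ∈ xs → x ∈ ys) → length xs ≤ length ys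
length-mono-∈ {xs = xs} {ys} unique xs⊆ys = injective⇒≤ {f = position} injective
  where
  position : Fin (length xs) → Fin (length ys)
  position i = Any.index (xs⊆ys (∈-lookup i))
  injective : ∀ {i j} → position i ≡ position j → i ≡ j
  injective {i} {j} eq = lookup-injective unique
    (trans (lookup-index (xs⊆ys (∈-lookup i)))
      (trans (cong (lookup ys) eq) (sym (lookup-index (xs⊆ys (∈-lookup j))))))

𝒱₂-≡ : ∀ {n} {p q : 𝒱₂ n} → proj₁ p ≡ proj₁ q → p ≡ q
𝒱₂-≡ {p = p , _} refl = cong (p ,_) (ℕ.≡-irrelevant _ _)

-- Otherwise p would lie in a singleton. In a subtree containing p, this gives every leaf another
-- vertex to be connected to.
other-element : ∀ {n} (p : 𝒱₂ n) v → ∃[ w ] w ∈ₛ proj₁ p × w ≢ v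
other-element (p , ∣p∣≡2) v with any? (λ w → w ∈? p ×-dec ¬? (w ≟ v))
... | yes found = found
... | no ¬found = contradiction
  (subst (2 ≤_) (∣⁅x⁆∣≡1 v) (subst (_≤ card ⁅ v ⁆) ∣p∣≡2 (p⊆q⇒∣p∣≤∣q∣ p⊆⁅v⁆)))
  (λ { (ℕ.s≤s ()) })
  where
  p⊆⁅v⁆ : p ⊆ ⁅ v ⁆
  p⊆⁅v⁆ {w} w∈p with w ≟ v
  ... | yes refl = x∈⁅x⁆ v
  ... | no w≢v   = contradiction (w , w∈p , w≢v) ¬found

∈-pairˡ : ∀ {n} (u v : Fin n) → u ∈ₛ ⁅ u ⁆ ∪ ⁅ v ⁆
∈-pairˡ u v = x∈p∪q⁺ (inj₁ (x∈⁅x⁆ u))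

∈-pairʳ : ∀ {n} (u v : Fin n) → v ∈ₛ ⁅ u ⁆ ∪ ⁅ v ⁆
∈-pairʳ u v = x∈p∪q⁺ (inj₂ (x∈⁅x⁆ v))

∈-pair⁻ : ∀ {n} {w : Fin n} u v → w ∈ₛ ⁅ u ⁆ ∪ ⁅ v ⁆ → w ≡ u ⊎ w ≡ v
∈-pair⁻ u v w∈ with x∈p∪q⁻ ⁅ u ⁆ ⁅ v ⁆ w∈
... | inj₁ h = inj₁ (x∈⁅y⁆⇒x≡y u h)
... | inj₂ h = inj₂ (x∈⁅y⁆⇒x≡y v h)

pair-⊆ : ∀ {n} {u v : Fin n} {p : Subset n} → u ∈ₛ p → v ∈ₛ p → ⁅ u ⁆ ∪ ⁅ v ⁆ ⊆ p
pair-⊆ {u = u} {v} u∈p v∈p w∈ with ∈-pair⁻ u v w∈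
... | inj₁ refl = u∈p
... | inj₂ refl = v∈p

module _ {m} (c : Fin (suc m)) where

  leaf∈spoke⇒≡ : ∀ {k l} → punchIn c k ∈ₛ proj₁ (spoke c l) → k ≡ l
  leaf∈spoke⇒≡ {k} {l} k∈ with ∈-pair⁻ c (punchIn c l) k∈
  ... | inj₁ eq = contradiction eq (punchInᵢ≢i c k)
  ... | inj₂ eq = punchIn-injective c k l eq

  spoke-injective : ∀ {k l} → spoke c k ≡ spoke c l → k ≡ l
  spoke-injective {k} {l} eq =
    leaf∈spoke⇒≡ (subst (λ e → punchIn c k ∈ₛ proj₁ e) eq (∈-pairʳ c (punchIn c k)))

  -- A leaf of the star lies on a single edge, so a connected subgraph reaching
  -- anything else from that leaf uses this edge.
  spoke∈subtree : ∀ (H : Tree (suc m)) → Tree.graph H ⊑ Tree.graph (star c) →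
                  ∀ {k w} → punchIn c k ∈ₛ Tree.vertices H → w ∈ₛ Tree.vertices H → w ≢ punchIn c k →
                  spoke c k ∈ Tree.edges H
  spoke∈subtree H H⊑T {k} k∈H w∈H w≢k with Tree.connected H k∈H w∈H
  ... | ε = contradiction refl w≢k
  ... | _◅_ {j = x} (e , e∈H , eq) _ with l , refl ← ∈-tabulate⁻ (_⊑_.edges-⊆ H⊑T e∈H) =
    subst (λ k → spoke c k ∈ Tree.edges H) (sym k≡l) e∈H
    where
    k≡l : k ≡ l
    k≡l = leaf∈spoke⇒≡ (subst (punchIn c k ∈ₛ_) (sym eq) (∈-pairˡ (punchIn c k) x))

  substarVertices : List (Fin m) → Subset (suc m)
  substarVertices []       = ⁅ c ⁆
  substarVertices (k ∷ ks) = ⁅ punchIn c k ⁆ ∪ substarVertices ks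

  centre∈substar : ∀ ks → c ∈ₛ substarVertices ks
  centre∈substar []       = x∈⁅x⁆ c
  centre∈substar (k ∷ ks) = x∈p∪q⁺ (inj₂ (centre∈substar ks))

  leaf∈substar : ∀ {ks k} → k ∈ ks → punchIn c k ∈ₛ substarVertices ks
  leaf∈substar (here refl) = x∈p∪q⁺ (inj₁ (x∈⁅x⁆ _))
  leaf∈substar (there k∈)  = x∈p∪q⁺ (inj₂ (leaf∈substar k∈))

  ∈-substar⁻ : ∀ ks {u} → u ∈ₛ substarVertices ks → u ≡ c ⊎ ∃[ k ] k ∈ ks × u ≡ punchIn c k
  ∈-substar⁻ [] u∈ = inj₁ (x∈⁅y⁆⇒x≡y c u∈)
  ∈-substar⁻ (k ∷ ks) u∈ with x∈p∪q⁻ ⁅ punchIn c k ⁆ (substarVertices ks) u∈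
  ... | inj₁ h = inj₂ (k , here refl , x∈⁅y⁆⇒x≡y _ h)
  ... | inj₂ h with ∈-substar⁻ ks h
  ...   | inj₁ eq            = inj₁ eq
  ...   | inj₂ (l , l∈ , eq) = inj₂ (l , there l∈ , eq)

  substarGraph : ∀ ks → Unique ks → Graph (suc m)
  substarGraph ks unique = record
    { vertices = substarVertices ks
    ; edges    = List.map (spoke c) ks
    ; unique   = Unique.map⁺ spoke-injective unique
    ; incident = All.map⁺ (All.tabulate λ k∈ → pair-⊆ (centre∈substar ks) (leaf∈substar k∈))
    }

  substarGraph⊑star : ∀ ks unique → substarGraph ks unique ⊑ Tree.graph (star c)
  substarGraph⊑star ks unique = record { vertices-⊆ = λ _ → ∈⊤ ; edges-⊆ = edge }
    where
    edge : ∀ {e} → e ∈ List.map (spoke c) ks → e ∈ Tree.edges (star c)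
    edge e∈ with k , _ , refl ← ∈-map⁻ (spoke c) e∈ = ∈-tabulate⁺ k

  substar : ∀ ks → Unique ks → Tree (suc m)
  substar ks unique = record
    { graph     = substarGraph ks unique
    ; nonempty  = c , centre∈substar ks
    ; connected = walk
    -- A cycle of the substar would also be a cycle of the star.
    ; acyclic   = λ { u vs (2≤ , distinct , linked) → Tree.acyclic (star c) u vs
        (2≤ , distinct , Linked.map (λ { (e , e∈ , eq) →
          e , _⊑_.edges-⊆ (substarGraph⊑star ks unique) e∈ , eq }) linked) }
    }
    where
    open Graph (substarGraph ks unique) using (vertices; Adj; Connected)
    fromCentre : ∀ {v} → v ∈ₛ vertices → Star Adj c v
    fromCentre v∈ with ∈-substar⁻ ks v∈
    ... | inj₁ refl            = ε
    ... | inj₂ (k , k∈ , refl) = (spoke c k , ∈-map⁺ (spoke c) k∈ , refl) ◅ ε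
    walk : Connected
    walk u∈ v∈ with ∈-substar⁻ ks u∈
    ... | inj₁ refl            = fromCentre v∈
    ... | inj₂ (k , k∈ , refl) =
      (spoke c k , ∈-map⁺ (spoke c) k∈ , ∪-comm ⁅ c ⁆ ⁅ punchIn c k ⁆) ◅ fromCentre v∈

  -- The substar on `ks` gives the upper bound. For the lower bound, each leaf of `ks` lies in p or
  -- q, hence in any competing subtree, which must then contain its spoke.
  steinerDistance-star : ∀ {p q d} ks → Unique ks →
    All (λ k → punchIn c k ∈ₛ proj₁ p ⊎ punchIn c k ∈ₛ proj₁ q) ks →
    proj₁ p ⊆ substarVertices ks → proj₁ q ⊆ substarVertices ks →
    IsSteinerDistance (star c) p q d → d ≡ length ks
  steinerDistance-star {p} {q} {d} ks unique covered p⊆ q⊆ isDistance = ℕ.≤-antisym d≤ ≤d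
    where
    open IsSteinerDistance isDistance
    d≤ : d ≤ length ks
    d≤ = subst (d ≤_) (length-map (spoke c) ks) (minimal (substar ks unique)
      (record { subgraph = substarGraph⊑star ks unique ; containsˡ = p⊆ ; containsʳ = q⊆ }))
    ≤d : length ks ≤ d
    ≤d with H , contains , refl ← attained =
      subst (_≤ Tree.size H) (length-map (spoke c) ks)
        (length-mono-∈ (Unique.map⁺ spoke-injective unique) edge∈H)
      where
      open IsSubtreeContaining contains
      edge∈H : ∀ {e} → e ∈ List.map (spoke c) ks → e ∈ Tree.edges H
      edge∈H e∈ with k , k∈ , refl ← ∈-map⁻ (spoke c) e∈
        -- The second vertex is taken from p even when the leaf comes from q.
        with w , w∈p , w≢k ← other-element p (punchIn c k) =
        spoke∈subtree H subgraph ([ containsˡ , containsʳ ]′ (All.lookup covered k∈)) (containsˡ w∈p) w≢k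

-- Entries of the distance matrix

module _ {m} (c : Fin (suc m)) (D : 𝒱₂ (suc m) → 𝒱₂ (suc m) → ℕ) (isD : Is𝔇₂ (star c) D) where

  D-spoke-spoke : ∀ k → D (spoke c k) (spoke c k) ≡ 1
  D-spoke-spoke k = steinerDistance-star c (k ∷ []) ([] ∷ [])
    (inj₁ (∈-pairʳ c (punchIn c k)) ∷ []) ⊆-substar ⊆-substar (isD (spoke c k) (spoke c k))
    where
    ⊆-substar : proj₁ (spoke c k) ⊆ substarVertices c (k ∷ [])
    ⊆-substar = pair-⊆ (centre∈substar c (k ∷ [])) (leaf∈substar c {k ∷ []} (here refl))

  D-spoke-spoke′ : ∀ {k l} → k ≢ l → D (spoke c k) (spoke c l) ≡ 2
  D-spoke-spoke′ {k} {l} k≢l = steinerDistance-star c (k ∷ l ∷ []) ((k≢l ∷ []) ∷ [] ∷ [])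
    (inj₁ (∈-pairʳ c (punchIn c k)) ∷ inj₂ (∈-pairʳ c (punchIn c l)) ∷ [])
    (pair-⊆ (centre∈substar c (k ∷ l ∷ [])) (leaf∈substar c {k ∷ l ∷ []} (here refl)))
    (pair-⊆ (centre∈substar c (k ∷ l ∷ [])) (leaf∈substar c {k ∷ l ∷ []} (there (here refl))))
    (isD (spoke c k) (spoke c l))

  module _ {p q : Fin m} (p≢q : p ≢ q) (f : 𝒱₂ (suc m)) (f≡ : proj₁ f ≡ ⁅ punchIn c p ⁆ ∪ ⁅ punchIn c q ⁆) where

    private
      p∈f : punchIn c p ∈ₛ proj₁ f
      p∈f = subst (punchIn c p ∈ₛ_) (sym f≡) (∈-pairˡ (punchIn c p) (punchIn c q))

      q∈f : punchIn c q ∈ₛ proj₁ f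
      q∈f = subst (punchIn c q ∈ₛ_) (sym f≡) (∈-pairʳ (punchIn c p) (punchIn c q))

      f-⊆ : ∀ ks → proj₁ f ⊆ substarVertices c (p ∷ q ∷ ks)
      f-⊆ ks = subst (_⊆ substarVertices c (p ∷ q ∷ ks)) (sym f≡)
        (pair-⊆ (leaf∈substar c {p ∷ q ∷ ks} (here refl)) (leaf∈substar c {p ∷ q ∷ ks} (there (here refl))))

      spoke-⊆ : ∀ {k ks} → k ∈ ks → proj₁ (spoke c k) ⊆ substarVertices c ks
      spoke-⊆ {ks = ks} k∈ = pair-⊆ (centre∈substar c ks) (leaf∈substar c k∈)

    D-f-f : D f f ≡ 2
    D-f-f = steinerDistance-star c (p ∷ q ∷ []) ((p≢q ∷ []) ∷ [] ∷ [])
      (inj₁ p∈f ∷ inj₁ q∈f ∷ []) (f-⊆ []) (f-⊆ []) (isD f f)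

    D-f-spoke : ∀ {k} → k ∈ p ∷ q ∷ [] → D f (spoke c k) ≡ 2 × D (spoke c k) f ≡ 2
    D-f-spoke {k} k∈ =
      steinerDistance-star c (p ∷ q ∷ []) ((p≢q ∷ []) ∷ [] ∷ [])
        (inj₁ p∈f ∷ inj₁ q∈f ∷ []) (f-⊆ []) (spoke-⊆ k∈) (isD f (spoke c k)) ,
      steinerDistance-star c (p ∷ q ∷ []) ((p≢q ∷ []) ∷ [] ∷ [])
        (inj₂ p∈f ∷ inj₂ q∈f ∷ []) (spoke-⊆ k∈) (f-⊆ []) (isD (spoke c k) f)

    D-f-spoke′ : ∀ {k} → p ≢ k → q ≢ k → D f (spoke c k) ≡ 3 × D (spoke c k) f ≡ 3
    D-f-spoke′ {k} p≢k q≢k =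
      steinerDistance-star c (p ∷ q ∷ k ∷ []) distinct
        (inj₁ p∈f ∷ inj₁ q∈f ∷ inj₂ k∈spoke ∷ []) (f-⊆ (k ∷ [])) (spoke-⊆ k∈) (isD f (spoke c k)) ,
      steinerDistance-star c (p ∷ q ∷ k ∷ []) distinct
        (inj₂ p∈f ∷ inj₂ q∈f ∷ inj₁ k∈spoke ∷ []) (spoke-⊆ k∈) (f-⊆ (k ∷ [])) (isD (spoke c k) f)
      where
      distinct : Unique (p ∷ q ∷ k ∷ [])
      distinct = (p≢q ∷ p≢k ∷ []) ∷ (q≢k ∷ []) ∷ [] ∷ []
      k∈ : k ∈ p ∷ q ∷ k ∷ []
      k∈ = there (there (here refl))
      k∈spoke : punchIn c k ∈ₛ proj₁ (spoke c k)
      k∈spoke = ∈-pairʳ c (punchIn c k)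

    private
      E = Tree.edges (star c)

    -- Matrix indices live in `Fin (length E)`, whose size equals m only propositionally; `leaf` and
    -- `position` translate between edges and leaves.
    leaf : Fin (length E) → Fin m
    leaf s = proj₁ (∈-tabulate⁻ {f = spoke c} (∈-lookup {xs = E} s))

    lookup≡spoke : ∀ s → lookup E s ≡ spoke c (leaf s)
    lookup≡spoke s = proj₂ (∈-tabulate⁻ {f = spoke c} (∈-lookup {xs = E} s))

    leaf-injective : ∀ {r s} → leaf r ≡ leaf s → r ≡ s
    leaf-injective {r} {s} eq = lookup-injective (Tree.unique (star c))
      (trans (lookup≡spoke r) (trans (cong (spoke c) eq) (sym (lookup≡spoke s))))

    position : Fin m → Fin (length E)
    position k = Any.index (∈-tabulate⁺ {f = spoke c} k)

    leaf-position : ∀ k → leaf (position k) ≡ k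
    leaf-position k = spoke-injective c
      (trans (sym (lookup≡spoke (position k))) (sym (lookup-index (∈-tabulate⁺ {f = spoke c} k))))

    position-≢ : position p ≢ position q
    position-≢ eq = p≢q (trans (sym (leaf-position p)) (trans (cong leaf eq) (leaf-position q)))

    private
      both : ∀ {a b d} → a ≡ d × b ≡ d → ℤ.+ a ≡ ℤ.+ d × ℤ.+ b ≡ ℤ.+ d
      both (x , y) = cong ℤ.+_ x , cong ℤ.+_ y

    -- f already needs the leaves p and q; a spoke adds a third leaf unless it ends in one of them.
    D-border : ∀ s → (ℤ.+ D f (lookup E s) ≡ border (position p) (position q) s) ×
                     (ℤ.+ D (lookup E s) f ≡ border (position p) (position q) s)
    D-border s rewrite lookup≡spoke s with position p ≟ s | position q ≟ s
    ... | yes refl | yes eq   = contradiction (sym eq) position-≢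
    ... | yes refl | no _     = both (D-f-spoke (here (leaf-position p)))
    ... | no _     | yes refl = both (D-f-spoke (there (here (leaf-position q))))
    ... | no p≢s   | no q≢s   = both (D-f-spoke′ (p≢s ∘ position≡) (q≢s ∘ position≡))
      where
      position≡ : ∀ {k} → k ≡ leaf s → position k ≡ s
      position≡ eq = leaf-injective (trans (leaf-position _) eq)

    D-spokes : ∀ r s → ℤ.+ D (lookup E r) (lookup E s) ≡ ℤ.+ 2 ℤ.- identity r s
    D-spokes r s rewrite lookup≡spoke r | lookup≡spoke s with r ≟ s
    ... | yes refl = cong ℤ.+_ (D-spoke-spoke (leaf s))
    ... | no r≢s   = cong ℤ.+_ (D-spoke-spoke′ (r≢s ∘ leaf-injective))

    isStarMatrix : IsStarMatrix (principalSubmatrix (λ e e′ → ℤ.+ D e e′) (f ∷ E)) (position p) (position q)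
    isStarMatrix = record
      { corner = cong ℤ.+_ D-f-f
      ; row    = proj₁ ∘ D-border
      ; column = proj₂ ∘ D-border
      ; spokes = D-spokes
      }

-- A pair through the centre is a spoke, up to the order of its two elements.
doubleton-nonEdge : ∀ {m} (c i j : Fin (suc m)) (i≢j : i ≢ j) →
                    doubleton i j i≢j ∉ Tree.edges (star c) → c ≢ i × c ≢ j
doubleton-nonEdge c i j i≢j ∉E = c≢i , c≢j
  where
  spoke≡ : ∀ {k} → c ≢ k → ∃[ l ] proj₁ (spoke c l) ≡ ⁅ c ⁆ ∪ ⁅ k ⁆
  spoke≡ c≢k = punchOut c≢k , cong (λ v → ⁅ c ⁆ ∪ ⁅ v ⁆) (punchIn-punchOut c≢k)
  c≢i : c ≢ i
  c≢i refl with l , eq ← spoke≡ i≢j =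
    ∉E (subst (_∈ Tree.edges (star c)) (𝒱₂-≡ eq) (∈-tabulate⁺ l))
  c≢j : c ≢ j
  c≢j refl with l , eq ← spoke≡ (≢-sym i≢j) =
    ∉E (subst (_∈ Tree.edges (star c)) (𝒱₂-≡ (trans eq (∪-comm ⁅ c ⁆ ⁅ i ⁆))) (∈-tabulate⁺ l))

-- Binomial coefficients

module _ where
  open import Data.Nat.Base
  open import Data.Nat.Properties
  open import Data.Integer.Base using (∣_∣; _⊖_)
  open import Data.Integer.Properties using (∣⊖∣-≤; m-n≡m⊖n; pos-+; pos-*)
  import Data.Integer.Tactic.RingSolver as ℤ-Solver
  open import Data.Nat.Tactic.RingSolver using (solve-∀)
  open ≤-Reasoning

  -- The identity (k + 1) C(n, k + 1) = (n - k) C(n, k) without subtraction, hence valid for every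
  -- k. Induction on n through Pascal's rule.
  absorption : ∀ n k → suc k * (n C suc k) + k * (n C k) ≡ n * (n C k)
  absorption zero    zero    = refl
  absorption zero    (suc k) = cong₂ _+_ (*-zeroʳ (suc (suc k))) (*-zeroʳ (suc k))
  absorption (suc n) zero    rewrite nC1≡n (suc n) | nC0≡1 (suc n) = lemma n
    where
    lemma : ∀ n → 1 * suc n + 0 ≡ suc n * 1
    lemma = solve-∀
  absorption (suc n) (suc k)
    rewrite sym (nCk+nC[k+1]≡[n+1]C[k+1] n k) | sym (nCk+nC[k+1]≡[n+1]C[k+1] n (suc k)) =
    combine (n C k) (n C suc k) (n C suc (suc k)) (absorption n (suc k)) (absorption n k)
    where
    -- The left sides of the two induction hypotheses, at k + 1 and at k, appear with y + x left
    -- over; this remainder raises the factor n to n + 1.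
    regroup : ∀ k x y z → suc (suc k) * (y + z) + suc k * (x + y) ≡
                          suc (suc k) * z + suc k * y + (suc k * y + k * x) + (y + x)
    regroup = solve-∀
    collect : ∀ n x y → n * y + n * x + (y + x) ≡ suc n * (x + y)
    collect = solve-∀
    combine : ∀ x y z → suc (suc k) * z + suc k * y ≡ n * y → suc k * y + k * x ≡ n * x →
              suc (suc k) * (y + z) + suc k * (x + y) ≡ suc n * (x + y)
    combine x y z eq₁ eq₂ = trans (regroup k x y z)
      (trans (cong₂ (λ u v → u + v + (y + x)) eq₁ eq₂) (collect n x y))

  nCk>0 : ∀ {n k} → k ≤ n → 0 < n C k
  nCk>0 {n} {zero} z≤n = ≤-reflexive (sym (nC0≡1 n))
  nCk>0 {suc n} {suc k} (s≤s k≤n) = begin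
    1                   ≤⟨ nCk>0 k≤n ⟩
    n C k               ≤⟨ m≤m+n (n C k) (n C suc k) ⟩
    n C k + n C suc k   ≡⟨ nCk+nC[k+1]≡[n+1]C[k+1] n k ⟩
    suc n C suc k       ∎

  private
    double : ∀ k x → suc k * x + k * x ≡ suc (2 * k) * x
    double = solve-∀

  -- Adding k C(n, k) turns (k + 1) C(n, k) into (2k + 1) C(n, k) and, by absorption, (k + 1) C(n, k
  -- + 1) into n C(n, k). So the question is how 2k + 1 compares with n; `nCk-falls` is the opposite
  -- case.
  nCk-rises : ∀ {n k} → suc (2 * k) ≤ n → n C k ≤ n C suc k
  nCk-rises {n} {k} 2k<n = *-cancelˡ-≤ (suc k) (+-cancelʳ-≤ (k * (n C k)) _ _ (begin
    suc k * (n C k) + k * (n C k)     ≡⟨ double k (n C k) ⟩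
    suc (2 * k) * (n C k)             ≤⟨ *-monoˡ-≤ (n C k) 2k<n ⟩
    n * (n C k)                       ≡⟨ absorption n k ⟨
    suc k * (n C suc k) + k * (n C k) ∎))

  nCk-falls : ∀ {n k} → n ≤ suc (2 * k) → n C suc k ≤ n C k
  nCk-falls {n} {k} n≤ = *-cancelˡ-≤ (suc k) (+-cancelʳ-≤ (k * (n C k)) _ _ (begin
    suc k * (n C suc k) + k * (n C k) ≡⟨ absorption n k ⟩
    n * (n C k)                       ≤⟨ *-monoˡ-≤ (n C k) n≤ ⟩
    suc (2 * k) * (n C k)             ≡⟨ double k (n C k) ⟨
    suc k * (n C k) + k * (n C k)     ∎))

  -- The factor n - k in absorption is at least 1.
  nCk≤[k+1]*nC[k+1] : ∀ {n k} → k < n → n C k ≤ suc k * (n C suc k)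
  nCk≤[k+1]*nC[k+1] {n} {k} k<n = +-cancelʳ-≤ (k * (n C k)) _ _ (begin
    suc k * (n C k)                   ≤⟨ *-monoˡ-≤ (n C k) k<n ⟩
    n * (n C k)                       ≡⟨ absorption n k ⟨
    suc k * (n C suc k) + k * (n C k) ∎)

  -- This is p - q < p′ - q′ in additive form; the sign of the second difference follows from that
  -- of the first.
  ∣⊖∣-mono-< : ∀ p q p′ q′ → q ≤ p → p + q′ < p′ + q → ∣ q ⊖ p ∣ < ∣ q′ ⊖ p′ ∣
  ∣⊖∣-mono-< p q p′ q′ q≤p lt = begin-strict
    ∣ q ⊖ p ∣    ≡⟨ ∣⊖∣-≤ q≤p ⟩
    p ∸ q        <⟨ +-cancelʳ-< (q + q′) _ _ (begin-strict
      p ∸ q + (q + q′)    ≡⟨ +-assoc (p ∸ q) q q′ ⟨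
      p ∸ q + q + q′      ≡⟨ cong (_+ q′) (m∸n+n≡m q≤p) ⟩
      p + q′              <⟨ lt ⟩
      p′ + q              ≡⟨ cong (_+ q) (m∸n+n≡m q′≤p′) ⟨
      p′ ∸ q′ + q′ + q    ≡⟨ +-assoc (p′ ∸ q′) q′ q ⟩
      p′ ∸ q′ + (q′ + q)  ≡⟨ cong (p′ ∸ q′ +_) (+-comm q′ q) ⟩
      p′ ∸ q′ + (q + q′)  ∎) ⟩
    p′ ∸ q′      ≡⟨ ∣⊖∣-≤ q′≤p′ ⟨
    ∣ q′ ⊖ p′ ∣  ∎
    where
    q′≤p′ : q′ ≤ p′
    q′≤p′ = <⇒≤ (+-cancelʳ-< p _ _ (begin-strict
      q′ + p  ≡⟨ +-comm q′ p ⟩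
      p + q′  <⟨ lt ⟩
      p′ + q  ≤⟨ +-monoʳ-≤ p′ q≤p ⟩
      p′ + p  ∎))

  -- Growth and decay of the absolute coefficients

  module Coefficients (N : ℕ) where

    private
      m : ℕ
      m = suc (suc N)

      c : ℕ → ℕ
      c = N C_

    -- The contribution of the three lower coefficients of the cubic, all of them negative;
    -- `positive` is that of its leading term.
    negative : ℕ → ℕ
    negative 0             = m * c 0
    negative 1             = m * c 1 + 7 * suc N * c 0
    negative (suc (suc j)) = m * c (suc (suc j)) + 7 * suc N * c (suc j) + 2 * m * c j

    positive : ℕ → ℕ
    positive (suc (suc (suc j))) = c j
    positive _                   = 0

    coefficient≡ : ∀ k → binomialConvolution N (cubic m) k ≡ positive k ⊖ negative k
    coefficient≡ k = trans (by k) (m-n≡m⊖n (positive k) (negative k))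
      where
      pos-7* : ∀ a x b y → ℤ.+ (a * x + 7 * b * y) ≡ ℤ.+ a ℤ.* ℤ.+ x ℤ.+ ℤ.+ 7 ℤ.* ℤ.+ b ℤ.* ℤ.+ y
      pos-7* a x b y = trans (pos-+ (a * x) _)
        (cong₂ ℤ._+_ (pos-* a x) (trans (pos-* (7 * b) y) (cong (ℤ._* ℤ.+ y) (pos-* 7 b))))
      pos-2* : ∀ a x b y z → ℤ.+ (a * x + 7 * b * y + 2 * a * z) ≡
                             ℤ.+ a ℤ.* ℤ.+ x ℤ.+ ℤ.+ 7 ℤ.* ℤ.+ b ℤ.* ℤ.+ y ℤ.+ ℤ.+ 2 ℤ.* ℤ.+ a ℤ.* ℤ.+ z
      pos-2* a x b y z = trans (pos-+ (a * x + 7 * b * y) _)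
        (cong₂ ℤ._+_ (pos-7* a x b y) (trans (pos-* (2 * a) z) (cong (ℤ._* ℤ.+ z) (pos-* 2 a))))
      lemma₀ : ∀ a x → ℤ.- a ℤ.* x ≡ ℤ.0ℤ ℤ.- a ℤ.* x
      lemma₀ = ℤ-Solver.solve-∀
      lemma₁ : ∀ a x b y → ℤ.- a ℤ.* x ℤ.+ ℤ.- (ℤ.+ 7 ℤ.* b) ℤ.* y ≡ ℤ.0ℤ ℤ.- (a ℤ.* x ℤ.+ ℤ.+ 7 ℤ.* b ℤ.* y)
      lemma₁ = ℤ-Solver.solve-∀
      lemma₂ : ∀ a x b y z → ℤ.- a ℤ.* x ℤ.+ (ℤ.- (ℤ.+ 7 ℤ.* b) ℤ.* y ℤ.+ ℤ.- (ℤ.+ 2 ℤ.* a) ℤ.* z) ≡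
                             ℤ.0ℤ ℤ.- (a ℤ.* x ℤ.+ ℤ.+ 7 ℤ.* b ℤ.* y ℤ.+ ℤ.+ 2 ℤ.* a ℤ.* z)
      lemma₂ = ℤ-Solver.solve-∀
      lemma₃ : ∀ a x b y z w → ℤ.- a ℤ.* x ℤ.+ (ℤ.- (ℤ.+ 7 ℤ.* b) ℤ.* y ℤ.+ (ℤ.- (ℤ.+ 2 ℤ.* a) ℤ.* z ℤ.+ ℤ.1ℤ ℤ.* w)) ≡
                               w ℤ.- (a ℤ.* x ℤ.+ ℤ.+ 7 ℤ.* b ℤ.* y ℤ.+ ℤ.+ 2 ℤ.* a ℤ.* z)
      lemma₃ = ℤ-Solver.solve-∀
      monic : ∀ j → binomialConvolution N (ℤ.1ℤ ∷ []) j ≡ ℤ.1ℤ ℤ.* ℤ.+ c j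
      monic zero    = refl
      monic (suc j) = ℤ.+-identityʳ _
      by : ∀ k → binomialConvolution N (cubic m) k ≡ ℤ.+ positive k ℤ.- ℤ.+ negative k
      by 0 = trans (lemma₀ (ℤ.+ m) (ℤ.+ c 0)) (cong (ℤ._-_ ℤ.0ℤ) (sym (pos-* m (c 0))))
      by 1 = trans (lemma₁ (ℤ.+ m) (ℤ.+ c 1) (ℤ.+ suc N) (ℤ.+ c 0))
                   (cong (ℤ._-_ ℤ.0ℤ) (sym (pos-7* m (c 1) (suc N) (c 0))))
      by 2 = trans (lemma₂ (ℤ.+ m) (ℤ.+ c 2) (ℤ.+ suc N) (ℤ.+ c 1) (ℤ.+ c 0))
                   (cong (ℤ._-_ ℤ.0ℤ) (sym (pos-2* m (c 2) (suc N) (c 1) (c 0))))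
      by (suc (suc (suc j))) = trans
        (cong (λ e → ℤ.- ℤ.+ m ℤ.* ℤ.+ c (3 + j) ℤ.+ (ℤ.- (ℤ.+ 7 ℤ.* ℤ.+ suc N) ℤ.* ℤ.+ c (2 + j) ℤ.+
                      (ℤ.- (ℤ.+ 2 ℤ.* ℤ.+ m) ℤ.* ℤ.+ c (1 + j) ℤ.+ e))) (monic j))
        (trans (lemma₃ (ℤ.+ m) (ℤ.+ c (3 + j)) (ℤ.+ suc N) (ℤ.+ c (2 + j)) (ℤ.+ c (1 + j)) (ℤ.+ c j))
               (cong (ℤ._-_ (ℤ.+ c j)) (sym (pos-2* m (c (3 + j)) (suc N) (c (2 + j)) (c (1 + j))))))

    1+j≤2m : ∀ {j} → suc j ≤ N → suc j ≤ 2 * m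
    1+j≤2m j<N = ≤-trans j<N (≤-trans (m≤n+m N 2) (m≤m+n m (m + 0)))

    -- The last summand of `negative` suffices: C(N, j) ≤ (j + 1) C(N, j + 1) ≤ 2m C(N, j + 1). Only
    -- the leading coefficient, at k = m + 1, has the other sign.
    positive≤negative : ∀ {k} → k ≤ m → positive k ≤ negative k
    positive≤negative {0} _ = z≤n
    positive≤negative {1} _ = z≤n
    positive≤negative {2} _ = z≤n
    positive≤negative {suc (suc (suc j))} (s≤s (s≤s j<N)) = begin
      c j                  ≤⟨ nCk≤[k+1]*nC[k+1] {N} {j} j<N ⟩
      suc j * c (suc j)    ≤⟨ *-monoˡ-≤ (c (suc j)) (1+j≤2m j<N) ⟩
      2 * m * c (suc j)    ≤⟨ m≤n+m (2 * m * c (suc j)) (m * c (3 + j) + 7 * suc N * c (2 + j)) ⟩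
      negative (3 + j)     ∎

    -- The summands of `negative` do not decrease. For k ≤ 1 strictness comes from the summand that
    -- newly appears; from k = 2 on, the last summand has to outgrow `positive (suc k)`, while
    -- `positive k` is dropped.
    rise : ∀ {k} → suc (2 * k) ≤ N → ∣ positive k ⊖ negative k ∣ < ∣ positive (suc k) ⊖ negative (suc k) ∣
    rise {k} 2k<N =
      ∣⊖∣-mono-< (negative k) (positive k) (negative (suc k)) (positive (suc k))
        (positive≤negative {k} (≤-trans k≤N (m≤n+m N 2)))
        (≤-trans (by k 2k<N) (m≤m+n (negative (suc k)) (positive k)))
      where
      k≤N : k ≤ N
      k≤N = ≤-trans (m≤m+n k (k + 0)) (<⇒≤ 2k<N)
      by : ∀ k → suc (2 * k) ≤ N → negative k + positive (suc k) < negative (suc k)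
      by 0 h = begin-strict
        m * c 0 + 0                   ≡⟨ +-identityʳ (m * c 0) ⟩
        m * c 0                       ≤⟨ *-monoʳ-≤ m (nCk-rises {N} {0} h) ⟩
        m * c 1
          -- The implicit argument is the predecessor of 7 · suc N, which shows that factor to be
          -- positive.
          <⟨ m<m+n (m * c 1) (*-mono-≤ (s≤s (z≤n {N + 6 * suc N})) (nCk>0 {N} {0} z≤n)) ⟩
        m * c 1 + 7 * suc N * c 0     ∎
      by 1 h = begin-strict
        m * c 1 + 7 * suc N * c 0 + 0               ≡⟨ +-identityʳ _ ⟩
        m * c 1 + 7 * suc N * c 0
          ≤⟨ +-mono-≤ (*-monoʳ-≤ m (nCk-rises {N} {1} h)) (*-monoʳ-≤ (7 * suc N) (nCk-rises {N} {0} (≤-trans (s≤s z≤n) h))) ⟩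
        m * c 2 + 7 * suc N * c 1
          <⟨ m<m+n (m * c 2 + 7 * suc N * c 1) (*-mono-≤ (s≤s (z≤n {suc N + (m + 0)})) (nCk>0 {N} {0} z≤n)) ⟩
        m * c 2 + 7 * suc N * c 1 + 2 * m * c 0     ∎
      by (suc (suc j)) h = begin-strict
        m * c (2 + j) + 7 * suc N * c (1 + j) + 2 * m * c j + c j
          ≡⟨ +-assoc (m * c (2 + j) + 7 * suc N * c (1 + j)) (2 * m * c j) (c j) ⟩
        m * c (2 + j) + 7 * suc N * c (1 + j) + (2 * m * c j + c j)
          <⟨ +-mono-≤-< (+-mono-≤ (*-monoʳ-≤ m (nCk-rises {N} {2 + j} h))
               (*-monoʳ-≤ (7 * suc N) (nCk-rises {N} {1 + j} (≤-trans (s≤s (*-monoʳ-≤ 2 (n≤1+n (1 + j)))) h)))) core ⟩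
        m * c (3 + j) + 7 * suc N * c (2 + j) + 2 * m * c (1 + j) ∎
        where
        2j+5≤N : 4 + suc (2 * j) ≤ N
        2j+5≤N = subst (_≤ N) (shift j) h
          where
          shift : ∀ j → suc (2 * suc (suc j)) ≡ 4 + suc (2 * j)
          shift = solve-∀
        j<N : suc j ≤ N
        j<N = ≤-trans (s≤s (≤-trans (m≤m+n j (j + 0)) (m≤n+m (2 * j) 4))) 2j+5≤N
        -- N ≥ 2j + 5 gives N - j ≥ j + 5, so absorption leaves a surplus of 4 C(N, j).
        gap : 4 * c j + suc j * c j ≤ suc j * c (suc j)
        gap = +-cancelʳ-≤ (j * c j) _ _ (begin
          4 * c j + suc j * c j + j * c j   ≡⟨ regroup j (c j) ⟩
          (4 + suc (2 * j)) * c j           ≤⟨ *-monoˡ-≤ (c j) 2j+5≤N ⟩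
          N * c j                           ≡⟨ absorption N j ⟨
          suc j * c (suc j) + j * c j       ∎)
          where
          regroup : ∀ j x → 4 * x + suc j * x + j * x ≡ (4 + suc (2 * j)) * x
          regroup = solve-∀
        -- With Δ = C(N, j + 1) - C(N, j), the surplus reads 4 C(N, j) ≤ (j + 1) Δ, and j + 1 ≤ 2m.
        core : 2 * m * c j + c j < 2 * m * c (suc j)
        core = begin-strict
          2 * m * c j + c j
            <⟨ +-monoʳ-< (2 * m * c j) (m<m*n (c j) 4 {{>-nonZero (nCk>0 (<⇒≤ j<N))}} (s≤s (s≤s z≤n))) ⟩
          2 * m * c j + c j * 4                      ≤⟨ +-monoʳ-≤ (2 * m * c j) 4c≤[j+1]d ⟩
          2 * m * c j + suc j * (c (suc j) ∸ c j)
            ≤⟨ +-monoʳ-≤ (2 * m * c j) (*-monoˡ-≤ (c (suc j) ∸ c j) (1+j≤2m j<N)) ⟩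
          2 * m * c j + 2 * m * (c (suc j) ∸ c j)    ≡⟨ *-distribˡ-+ (2 * m) (c j) (c (suc j) ∸ c j) ⟨
          2 * m * (c j + (c (suc j) ∸ c j))          ≡⟨ cong (2 * m *_) (m+[n∸m]≡n c≤) ⟩
          2 * m * c (suc j)                          ∎
          where
          c≤ : c j ≤ c (suc j)
          c≤ = nCk-rises {N} {j} (≤-trans (m≤n+m (suc (2 * j)) 4) 2j+5≤N)
          4c≤[j+1]d : c j * 4 ≤ suc j * (c (suc j) ∸ c j)
          4c≤[j+1]d = +-cancelʳ-≤ (suc j * c j) _ _ (begin
            c j * 4 + suc j * c j                            ≡⟨ cong (_+ suc j * c j) (*-comm (c j) 4) ⟩
            4 * c j + suc j * c j                            ≤⟨ gap ⟩
            suc j * c (suc j)                                ≡⟨ cong (suc j *_) (m∸n+n≡m c≤) ⟨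
            suc j * (c (suc j) ∸ c j + c j)                  ≡⟨ *-distribˡ-+ (suc j) (c (suc j) ∸ c j) (c j) ⟩
            suc j * (c (suc j) ∸ c j) + suc j * c j          ∎)

    -- Past its own peak C(N, j) also falls, so the subtracted term may shrink. The drop 2m (C(N, j)
    -- - C(N, j + 1)) must make up for that; C(N, j) on the right is the spare amount that makes the
    -- inequality strict.
    fall-core : ∀ j → N ≤ suc (2 * j) → suc j ≤ N → 2 * m * c (suc j) + positive (2 + j) < 2 * m * c j + c j
    fall-core zero N≤ _ =
      +-mono-≤-< (*-monoʳ-≤ (2 * m) (nCk-falls {N} {0} N≤)) (nCk>0 {N} {0} z≤n)
    fall-core j@(suc i) N≤ j<N
      -- Here r = N - j - 1 and s = 2j + 1 - N, so s measures how far j is past the middle.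
      with r , N≡ ← m≤n⇒∃[o]m+o≡n j<N
      with s , j≡ ← m≤n⇒∃[o]m+o≡n (+-cancelˡ-≤ (suc j) r j
        (subst₂ _≤_ (sym N≡) (cong suc (cong (j +_) (+-identityʳ j))) N≤)) = begin-strict
      2 * m * c (suc j) + c i                          <⟨ +-monoʳ-< (2 * m * c (suc j)) (cᵢ<) ⟩
      2 * m * c (suc j) + (s * c j + c j)              ≤⟨ +-monoʳ-≤ (2 * m * c (suc j)) (+-monoˡ-≤ (c j) (begin
        s * c j          ≡⟨ [j+1]d≡ ⟨
        suc j * d        ≤⟨ *-monoˡ-≤ d (1+j≤2m j<N) ⟩
        2 * m * d        ∎)) ⟩
      2 * m * c (suc j) + (2 * m * d + c j)            ≡⟨ regroup (2 * m) (c (suc j)) d (c j) ⟩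
      2 * m * (c (suc j) + d) + c j                    ≡⟨ cong (λ x → 2 * m * x + c j) c+d≡ ⟩
      2 * m * c j + c j                                ∎
      where
      d = c j ∸ c (suc j)
      c+d≡ : c (suc j) + d ≡ c j
      c+d≡ = m+[n∸m]≡n (nCk-falls {N} {j} N≤)
      regroup : ∀ a x y z → a * x + (a * y + z) ≡ a * (x + y) + z
      regroup = solve-∀
      -- Absorption at j, with (j + 1) - (N - j) = s.
      [j+1]d≡ : suc j * d ≡ s * c j
      [j+1]d≡ = eliminate j r s (c (suc j)) d (c j) j≡ c+d≡ (trans (absorption N j) (cong (_* c j) (sym N≡)))
        where
        eliminate : ∀ j r s x d y → r + s ≡ j → x + d ≡ y → suc j * x + j * y ≡ (suc j + r) * y → suc j * d ≡ s * y
        eliminate _ r s x d _ refl refl eq =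
          +-cancelʳ-≡ (suc (r + s) * x + (r + s) * (x + d)) _ _ (trans (left (r + s) x d) (trans (right r s (x + d)) (cong (s * (x + d) +_) (sym eq))))
          where
          left : ∀ j x d → suc j * d + (suc j * x + j * (x + d)) ≡ (suc j + j) * (x + d)
          left = solve-∀
          right : ∀ r s y → (suc (r + s) + (r + s)) * y ≡ s * y + (suc (r + s) + r) * y
          right = solve-∀
      -- Absorption at i = j - 1, with N - i = r + 2 and j = r + s.
      [r+2]cᵢ≡ : (2 + r) * c i ≡ (r + s) * c j
      [r+2]cᵢ≡ = eliminate i r (c i) (c j) (trans (absorption N i) (cong (_* c i) (sym N≡))) j≡
        where
        eliminate : ∀ i r x y → suc i * y + i * x ≡ (suc (suc i) + r) * x → r + s ≡ suc i → (2 + r) * x ≡ (r + s) * y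
        eliminate i r x y eq j≡ =
          +-cancelʳ-≡ (i * x) _ _ (trans (expand i r x) (trans (sym eq) (cong (λ k → k * y + i * x) (sym j≡))))
          where
          expand : ∀ i r x → (2 + r) * x + i * x ≡ (suc (suc i) + r) * x
          expand = solve-∀
      -- After multiplication by r + 2 it remains that r + s < (r + 2)(s + 1), where the difference
      -- is 2 + s + rs.
      cᵢ< : c i < s * c j + c j
      cᵢ< = *-cancelˡ-< (2 + r) _ _ (begin-strict
        (2 + r) * c i                                 ≡⟨ [r+2]cᵢ≡ ⟩
        (r + s) * c j
          <⟨ m<m+n ((r + s) * c j) (*-mono-≤ (s≤s (z≤n {suc (s + r * s)})) (nCk>0 (<⇒≤ j<N))) ⟩
        (r + s) * c j + (2 + (s + r * s)) * c j       ≡⟨ expand r s (c j) ⟩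
        (2 + r) * (s * c j + c j)                     ∎)
        where
        expand : ∀ r s x → (r + s) * x + (2 + (s + r * s)) * x ≡ (2 + r) * (s * x + x)
        expand = solve-∀

    -- The first two summands of `negative` do not increase, since their indices are past the middle
    -- too; `fall-core` treats the third together with `positive`.
    fall : ∀ j → N ≤ suc (2 * j) → suc j ≤ N →
           ∣ positive (3 + j) ⊖ negative (3 + j) ∣ < ∣ positive (2 + j) ⊖ negative (2 + j) ∣
    fall j N≤ j<N = ∣⊖∣-mono-< (negative (3 + j)) (positive (3 + j)) (negative (2 + j)) (positive (2 + j))
      (positive≤negative {3 + j} (s≤s (s≤s j<N))) (begin-strict
      m * c (3 + j) + 7 * suc N * c (2 + j) + 2 * m * c (1 + j) + positive (2 + j)
        ≡⟨ +-assoc (m * c (3 + j) + 7 * suc N * c (2 + j)) (2 * m * c (1 + j)) (positive (2 + j)) ⟩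
      m * c (3 + j) + 7 * suc N * c (2 + j) + (2 * m * c (1 + j) + positive (2 + j))
        <⟨ +-mono-≤-< (+-mono-≤ (*-monoʳ-≤ m (nCk-falls {N} {2 + j} (later 2)))
             (*-monoʳ-≤ (7 * suc N) (nCk-falls {N} {1 + j} (later 1)))) (fall-core j N≤ j<N) ⟩
      m * c (2 + j) + 7 * suc N * c (1 + j) + (2 * m * c j + c j)
        ≡⟨ +-assoc (m * c (2 + j) + 7 * suc N * c (1 + j)) (2 * m * c j) (c j) ⟨
      m * c (2 + j) + 7 * suc N * c (1 + j) + 2 * m * c j + c j ∎)
      where
      later : ∀ i → N ≤ suc (2 * (i + j))
      later i = ≤-trans N≤ (s≤s (*-monoʳ-≤ 2 (m≤n+m j i)))

    positive-m≤N : positive m ≤ N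
    positive-m≤N = by N refl
      where
      by : ∀ n → n ≡ N → positive (2 + n) ≤ N
      by zero    _    = z≤n
      by (suc n) refl = begin
        N C n                  ≤⟨ nCk≤[k+1]*nC[k+1] {suc n} {n} ≤-refl ⟩
        suc n * (suc n C suc n) ≡⟨ cong (suc n *_) (nCn≡1 (suc n)) ⟩
        suc n * 1              ≡⟨ *-identityʳ (suc n) ⟩
        suc n                  ∎

    -- The sign changes here, so `∣⊖∣-mono-<` does not apply. The leading coefficient is 1, while
    -- `negative m` ≥ 2m and `positive m` ≤ N = m - 2.
    fall-last : ∣ positive (suc m) ⊖ negative (suc m) ∣ < ∣ positive m ⊖ negative m ∣
    fall-last = begin-strict
      ∣ positive (suc m) ⊖ negative (suc m) ∣   ≡⟨ cong₂ (λ x y → ∣ x ⊖ y ∣) (nCn≡1 N) negative≡0 ⟩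
      1                                         <⟨ m+n≤o⇒m≤o∸n 2 (begin
        2 + positive m        ≤⟨ +-monoʳ-≤ 2 positive-m≤N ⟩
        m                     ≤⟨ m≤m+n m (m + 0) ⟩
        2 * m                 ≡⟨ trans (cong (2 * m *_) (nCn≡1 N)) (*-identityʳ (2 * m)) ⟨
        2 * m * c N           ≤⟨ m≤n+m (2 * m * c N) (m * c m + 7 * suc N * c (suc N)) ⟩
        negative m            ∎) ⟩
      negative m ∸ positive m                   ≡⟨ ∣⊖∣-≤ (positive≤negative {m} ≤-refl) ⟨
      ∣ positive m ⊖ negative m ∣               ∎
      where
      negative≡0 : negative (suc m) ≡ 0
      negative≡0 rewrite k>n⇒nCk≡0 {N} {3 + N} (m≤n+m (suc N) 2)
                       | k>n⇒nCk≡0 {N} {2 + N} (m≤n+m (suc N) 1)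
                       | k>n⇒nCk≡0 {N} {1 + N} ≤-refl
                       | *-zeroʳ m | *-zeroʳ (7 * suc N) | *-zeroʳ (2 * m) = refl

    falls : ∀ k → N + 3 ≤ 2 * k → k ≤ m →
            ∣ positive (suc k) ⊖ negative (suc k) ∣ < ∣ positive k ⊖ negative k ∣
    falls k N+3≤2k k≤m with m≤n⇒m<n∨m≡n k≤m
    ... | inj₂ refl = fall-last
    falls 0 N+3≤2k _ | inj₁ _ = contradiction (≤-trans (m≤n+m 3 N) N+3≤2k) λ ()
    falls 1 N+3≤2k _ | inj₁ _ = contradiction (≤-trans (m≤n+m 3 N) N+3≤2k) λ { (s≤s (s≤s ())) }
    falls (suc (suc j)) N+3≤2k _ | inj₁ (s≤s (s≤s j<N)) =
      fall j (+-cancelʳ-≤ 3 N (suc (2 * j)) (subst (N + 3 ≤_) (shift j) N+3≤2k)) j<N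
      where
      shift : ∀ j → 2 * suc (suc j) ≡ suc (2 * j) + 3
      shift = solve-∀

  -- Position of the largest coefficient

  2*⌊n/2⌋≤n : ∀ n → 2 * ⌊ n /2⌋ ≤ n
  2*⌊n/2⌋≤n n = begin
    ⌊ n /2⌋ + (⌊ n /2⌋ + 0) ≡⟨ cong (⌊ n /2⌋ +_) (+-identityʳ ⌊ n /2⌋) ⟩
    ⌊ n /2⌋ + ⌊ n /2⌋       ≤⟨ +-monoʳ-≤ ⌊ n /2⌋ (⌊n/2⌋≤⌈n/2⌉ n) ⟩
    ⌊ n /2⌋ + ⌈ n /2⌉       ≡⟨ ⌊n/2⌋+⌈n/2⌉≡n n ⟩
    n                       ∎

  n≤2*⌈n/2⌉ : ∀ n → n ≤ 2 * ⌈ n /2⌉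
  n≤2*⌈n/2⌉ n = begin
    n                       ≡⟨ ⌊n/2⌋+⌈n/2⌉≡n n ⟨
    ⌊ n /2⌋ + ⌈ n /2⌉       ≤⟨ +-monoˡ-≤ ⌈ n /2⌉ (⌊n/2⌋≤⌈n/2⌉ n) ⟩
    ⌈ n /2⌉ + ⌈ n /2⌉       ≡⟨ cong (⌈ n /2⌉ +_) (+-identityʳ ⌈ n /2⌉) ⟨
    ⌈ n /2⌉ + (⌈ n /2⌉ + 0) ∎

  -- One neighbour refutes a t outside the range: t + 1 if t is too small, t - 1 if it is too large.
  -- Here n = N + 3.
  peak : ∀ N (a : ℕ → ℤ.ℤ) → (∀ k → a k ≡ binomialConvolution N (cubic (suc (suc N))) k) →
         ∀ t → t ≤ 3 + N → (∀ k → k ≤ 3 + N → ∣ a k ∣ ≤ ∣ a t ∣) →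
         ⌊ suc N /2⌋ ≤ t × t ≤ ⌈ 3 + N /2⌉
  peak N a a≡ t t≤n maximal = ≮⇒≥ not-below , ≮⇒≥ (not-above t t≤n maximal)
    where
    open Coefficients N
    abs≡ : ∀ k → ∣ a k ∣ ≡ ∣ positive k ⊖ negative k ∣
    abs≡ k = cong ∣_∣ (trans (a≡ k) (coefficient≡ k))
    not-below : ¬ t < ⌊ suc N /2⌋
    not-below t< = <⇒≱ (subst₂ _<_ (sym (abs≡ t)) (sym (abs≡ (suc t))) (rise {t} 2t<N))
                       (maximal (suc t) (≤-trans t<N (m≤n+m N 3)))
      where
      -- From t + 1 ≤ ⌊(N + 1)/2⌋ follows 2t + 2 ≤ N + 1.
      2t<N : suc (2 * t) ≤ N
      2t<N = s≤s⁻¹ (begin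
        2 + 2 * t          ≡⟨ *-distribˡ-+ 2 1 t ⟨
        2 * suc t          ≤⟨ *-monoʳ-≤ 2 t< ⟩
        2 * ⌊ suc N /2⌋    ≤⟨ 2*⌊n/2⌋≤n (suc N) ⟩
        suc N              ∎)
      t<N : suc t ≤ N
      t<N = ≤-trans (s≤s (m≤m+n t (t + 0))) 2t<N
    not-above : ∀ t → t ≤ 3 + N → (∀ k → k ≤ 3 + N → ∣ a k ∣ ≤ ∣ a t ∣) → ¬ ⌈ 3 + N /2⌉ < t
    not-above (suc k) (s≤s k≤m) maximal (s≤s ≤k) =
      <⇒≱ (subst₂ _<_ (sym (abs≡ (suc k))) (sym (abs≡ k)) (falls k N+3≤2k k≤m))
          (maximal k (m≤n⇒m≤1+n k≤m))
      where
      N+3≤2k : N + 3 ≤ 2 * k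
      N+3≤2k = begin
        N + 3                ≡⟨ +-comm N 3 ⟩
        3 + N                ≤⟨ n≤2*⌈n/2⌉ (3 + N) ⟩
        2 * ⌈ 3 + N /2⌉      ≤⟨ *-monoʳ-≤ 2 ≤k ⟩
        2 * k                ∎

open import Data.Integer.Base using (+_; ∣_∣)
open import Data.Nat.Base using (_∸_; ⌊_/2⌋; ⌈_/2⌉)

charPoly-peak : ∀ {m} {M : Matrix ℤ.ℤ (suc m)} {p q} → p ≢ q → IsStarMatrix M p q →
                let a = coeff (charPoly M) in
                ∀ t → t ≤ suc m → (∀ k → k ≤ suc m → ∣ a k ∣ ≤ ∣ a t ∣) →
                ⌊ suc m ∸ 2 /2⌋ ≤ t × t ≤ ⌈ suc m /2⌉
-- Two distinct leaves force m ≥ 2, so that N = m - 2 exists.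
charPoly-peak {0} {p = ()}
charPoly-peak {1} {p = zero} {zero} p≢q = contradiction refl p≢q
charPoly-peak {suc (suc N)} {M} p≢q isStar =
  peak N (coeff (charPoly M)) (coeff-charPoly p≢q isStar N refl)

theorem5p4 : (n : ℕ) (centre : Fin n) →
    let E = Tree.edges (star centre) in
    (D : 𝒱₂ n → 𝒱₂ n → ℕ) → Is𝔇₂ (star centre) D →
    (i j : Fin n) (i≢j : i ≢ j) → doubleton i j i≢j ∉ E →
    let B = doubleton i j i≢j ∷ E
        a = coeff (charPoly (principalSubmatrix (λ p q → + D p q) B))
    in
    (t : ℕ) → t ≤ n → (∀ k → k ≤ n → ∣ a k ∣ ≤ ∣ a t ∣) →
    ⌊ n ∸ 2 /2⌋ ≤ t × t ≤ ⌈ n /2⌉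
theorem5p4 (suc m) c D isD i j i≢j f∉E t =
  -- The matrix has size `suc (length E)`; only the bounds are transported to m, the coefficients
  -- `a` stay as they are.
  subst (λ l → t ≤ suc l → (∀ k → k ≤ suc l → ∣ a k ∣ ≤ ∣ a t ∣) →
               ⌊ suc l ∸ 2 /2⌋ ≤ t × t ≤ ⌈ suc l /2⌉)
    (length-tabulate (spoke c))
    (charPoly-peak (position-≢ c D isD p≢q f f≡) (isStarMatrix c D isD p≢q f f≡) t)
  where
  f = doubleton i j i≢j
  a = coeff (charPoly (principalSubmatrix (λ p q → + D p q) (f ∷ Tree.edges (star c))))
  c≢i = proj₁ (doubleton-nonEdge c i j i≢j f∉E)
  c≢j = proj₂ (doubleton-nonEdge c i j i≢j f∉E)
  p≢q : punchOut c≢i ≢ punchOut c≢j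
  p≢q = i≢j ∘ punchOut-injective c≢i c≢j
  f≡ : proj₁ f ≡ ⁅ punchIn c (punchOut c≢i) ⁆ ∪ ⁅ punchIn c (punchOut c≢j) ⁆
  f≡ = cong₂ (λ u v → ⁅ u ⁆ ∪ ⁅ v ⁆) (sym (punchIn-punchOut c≢i)) (sym (punchIn-punchOut c≢j))
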